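{- Let $p\ge5$ be a prime with Legendre symbol $\left(\frac{ -3}{p}\right)=-1$, and let $\alpha\ge0$, $n\ge0$ be integers. Then for every $i\in\{1,2,\dots,p-1\}$, $$\overline{S_9}\big(6p^{2\alpha+2}n+(6i+p)p^{2\alpha+1}\big)\equiv0\pmod 3.$$
   Context: For $|q|<1$ and a positive integer $k$, write $f_k=\prod_{j\ge1}(1-q^{kj})$. The function $\overline{S_9}(n)$ (number of $9$-Schur overpartitions of $n$) is defined by $\sum_{n\ge0}\overline{S_9}(n)q^n=\prod_{n\ge1}\frac{(1+q^{2n-1})(1-q^{9(2n-1)})}{(1+q^{9(2n-1)})(1-q^{2n-1})}=\frac{f_2^3f_9^2f_{36}}{f_1^2f_4f_{18}^3}$. -}

module Defs where

open import Data.Nat as ℕ using (ℕ; zero; suc)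
open import Data.Nat.DivMod using (_%_; _/_)
open import Data.Integer as ℤ using (ℤ; +_; -_)
open import Data.List using (List; []; _∷_; upTo; map; foldr)
open import Data.Bool using (if_then_else_)

Series : Set
Series = ℕ → ℤ

_·_ : Series → Series → Series
(f · g) n = foldr ℤ._+_ (+ 0) (map (λ k → f k ℤ.* g (n ℕ.∸ k)) (upTo (suc n)))

one : Series
one zero    = + 1
one (suc _) = + 0

-- 1 + c q^k  (k ≥ 1)
onePlus : ℤ → ℕ → Series
onePlus c k zero = + 1
onePlus c k n@(suc _) = if n ℕ.≡ᵇ k then c else + 0

-- 1 / (1 - c q^k) = Σ_j c^j q^{kj}  (k ≥ 1)
geomInv : ℤ → ℕ → Series
geomInv c k n = if n % suc (k ℕ.∸ 1) ℕ.≡ᵇ 0 then c ℤ.^ (n / suc (k ℕ.∸ 1)) else + 0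

-- The m-th factor (m ≥ 1) of the product defining the 9-Schur overpartitions:
--   (1 + q^{2m-1}) (1 - q^{9(2m-1)}) / ((1 + q^{9(2m-1)}) (1 - q^{2m-1}))
factor : ℕ → Series
factor m = ((onePlus (+ 1) o · onePlus (- + 1) (9 ℕ.* o))
              · geomInv (- + 1) (9 ℕ.* o)) · geomInv (+ 1) o
  where o = 2 ℕ.* m ℕ.∸ 1

partialProd : ℕ → Series
partialProd zero    = one
partialProd (suc N) = partialProd N · factor (suc N)

-- The coefficient of q^n in the infinite product: factors with m ≥ n+1 have
-- 2m-1 > n and therefore do not affect the coefficient of q^n.
S9bar : ℕ → ℤ
S9bar n = partialProd n n

open import Data.Integer.Divisibility using () renaming (_∣_ to _∣ℤ_)
open import Relation.Nullary using (¬_)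
open import Data.Product using (∃; _×_)

LegendreIsMinusOne : ℤ → ℕ → Set
LegendreIsMinusOne a p =
  (¬ (+ p ∣ℤ a)) × (¬ ∃ λ (x : ℤ) → + p ∣ℤ (x ℤ.* x ℤ.- a))

{-# OPTIONS --safe #-}
module Submission where

-- Modulo 3 the generating function is (φ(-q)/φ(q))⁴, where φ(q) = Σ q^{k²},
-- because φ(±q) = f₂ ∏ (1 ± q^{2j-1})² (Gauss) and 1 - q^{9m} ≡ (1 - q^m)⁹.
-- With f(q)³ ≡ f(q³) this equals φ(q)² φ(-q) · φ(q³) φ(-q³) / φ(q⁹), and from
-- φ(q) ≡ φ(q⁹) - q Ω(q³), Ω(q) = Σ q^{3k²-2k}, the terms q^n with n ≡ 1 mod 3 are
--   q (φ(-q⁹) Ω(q³) + φ(q⁹) Ω(-q³)) φ(q³) φ(-q³) = 2 q f₁₂² φ(q³) φ(-q³) = 2 q f₆⁴ ≡ 2 q f₆ f₁₈.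
-- By Euler's pentagonal number theorem the exponents n occurring on the right satisfy
-- 4n = (6u-1)² + 3(6v-1)², so an inert prime p divides them to an even power.
-- Everything takes place in F₃[q]/(q^{M+1}), where q is nilpotent and the
-- infinite products and sums are finite.

open import Defs
open import Algebra.Bundles using (CommutativeRing; RawRing)
import Algebra.Properties.CommutativeSemiring.Exp
import Algebra.Properties.Ring
import Algebra.Solver.Ring
open import Algebra.Solver.Ring.AlmostCommutativeRing
  using (_-Raw-AlmostCommutative⟶_; fromCommutativeRing)
open import Data.Bool using (Bool; true; false; if_then_else_)
open import Data.Empty using (⊥; ⊥-elim)
open import Data.Integer as ℤ using (ℤ; +_; -[1+_]; ∣_∣)
open import Data.Integer.Divisibility.Signed as ℤ∣ using (divides)
import Data.Integer.Properties as ℤₚ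
open import Data.Integer.Tactic.RingSolver using () renaming (solve-∀ to ℤ-solve)
open import Data.List using (foldr)
open import Data.List.Properties using (map-applyUpTo)
open import Data.Maybe.Base using (Maybe; just; nothing)
open import Data.Nat as ℕ using (ℕ; zero; suc; z≤n; s≤s)
open import Data.Nat.Coprimality using (Coprime; coprime-Bézout)
open import Data.Nat.Divisibility as ℕ∣ using ()
open import Data.Nat.DivMod using (_%_; _/_; [m+n]%n≡m%n; m<n⇒m%n≡m; m/n≡1+[m∸n]/n)
open import Data.Nat.GCD using (module Bézout)
open import Data.Nat.Primality using (Prime; euclidsLemma; prime⇒irreducible; prime⇒nonZero)
import Data.Nat.Properties as ℕₚ
open import Data.Nat.Tactic.RingSolver using () renaming (solve-∀ to ℕ-solve)
open import Data.Product using (Σ; ∃; _×_; _,_; proj₁; proj₂)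
open import Data.Sum using (_⊎_; inj₁; inj₂; [_,_]′)
open import Function using (_∘_)
open import Level using (0ℓ; _⊔_)
open import Relation.Binary.PropositionalEquality as ≡ using (_≡_; _≢_)
open import Relation.Nullary using (¬_; yes; no)

-- The exponents 1 mod 3 are the relevant ones because the index of the theorem is p^(2α+1) times a
-- cofactor congruent to p mod 6, hence congruent to p^(2α+2), which is 1 mod 3. That cofactor is
-- prime to p, so the valuation of the index at p is odd. Writing f₆⁴ as f₆ f₁₈ trades a product of
-- four sparse series for a product of two, and this makes the exponents values of a binary
-- quadratic form. The denominator φ(q⁹) is harmless: since -2 = 1, the part with exponents 1 mod 3
-- acquires a factor φ(q⁹) that cancels it, and about the other two parts one only has to know that
-- their cofactors stay in F₃[q³]. Gauss's and Euler's series are not drawn from the triple product.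
-- Both come from one telescoping recurrence for finite sums of Shanks, in which the quotients (x)_n
-- / (x)_r are polynomials; nilpotency enters only at the end, to discard a tail. The truncation
-- order M is the index itself, so the number of factors, the degree and the truncation agree.

data F₃ : Set where
  𝟘 𝟙 𝟚 : F₃

-- Serves as the coefficient ring of the ring solver. With coefficients in F₃ rather than ℤ,
-- identities that hold only in characteristic 3, such as additivity of cubing or -2 = 1, are
-- settled by normalisation.
F₃-rawRing : RawRing _ _
F₃-rawRing = record
  { Carrier = F₃ ; _≈_ = _≡_ ; _+_ = _⊕_ ; _*_ = _⊗_ ; -_ = ⊖_ ; 0# = 𝟘 ; 1# = 𝟙 }
  where
  _⊕_ _⊗_ : F₃ → F₃ → F₃
  𝟘 ⊕ y = y
  𝟙 ⊕ 𝟘 = 𝟙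
  𝟙 ⊕ 𝟙 = 𝟚
  𝟙 ⊕ 𝟚 = 𝟘
  𝟚 ⊕ 𝟘 = 𝟚
  𝟚 ⊕ 𝟙 = 𝟘
  𝟚 ⊕ 𝟚 = 𝟙
  𝟘 ⊗ y = 𝟘
  𝟙 ⊗ y = y
  𝟚 ⊗ 𝟘 = 𝟘
  𝟚 ⊗ 𝟙 = 𝟚
  𝟚 ⊗ 𝟚 = 𝟙
  ⊖_ : F₃ → F₃
  ⊖ 𝟘 = 𝟘
  ⊖ 𝟙 = 𝟚
  ⊖ 𝟚 = 𝟙

-- Arithmetic of the quadratic exponents

n<3^n : ∀ n → n ℕ.< 3 ℕ.^ n
n<3^n zero    = s≤s z≤n
n<3^n (suc n) = ℕₚ.<-≤-trans (s≤s (n<3^n n)) (ℕₚ.+-mono-≤ (ℕₚ.m^n>0 3 n) (ℕₚ.m≤m+n _ _))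

-- Recursive on purpose: `∑ (double L)` and `∑ (suc (triple L))` then unfold by computation when `L`
-- grows by one.
double triple : ℕ → ℕ
double zero    = zero
double (suc n) = suc (suc (double n))
triple zero    = zero
triple (suc n) = suc (suc (suc (triple n)))

double≡ : ∀ n → double n ≡ n ℕ.+ n
double≡ zero    = ≡.refl
double≡ (suc n) = ≡.cong suc (≡.trans (≡.cong suc (double≡ n)) (≡.sym (ℕₚ.+-suc n n)))

triple≡ : ∀ n → triple n ≡ n ℕ.+ (n ℕ.+ n)
triple≡ zero    = ≡.refl
triple≡ (suc n) = ≡.trans (≡.cong (λ k → suc (suc (suc k))) (triple≡ n)) (eq n)
  where
  eq : ∀ n → 3 ℕ.+ (n ℕ.+ (n ℕ.+ n)) ≡ suc n ℕ.+ (suc n ℕ.+ suc n)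
  eq = ℕ-solve

-- k²,  k (3k - 2)  and  k (3k - 1)
sq oct pent : ℤ → ℕ
sq k = ∣ k ∣ ℕ.* ∣ k ∣
oct (+ zero)   = 0
oct (+ suc m)  = suc m ℕ.* (suc m ℕ.+ (m ℕ.+ m))
oct -[1+ m ]   = suc m ℕ.* (suc m ℕ.+ (suc (suc m) ℕ.+ suc (suc m)))
pent (+ zero)  = 0
pent (+ suc m) = suc m ℕ.* (suc m ℕ.+ (m ℕ.+ suc m))
pent -[1+ m ]  = suc m ℕ.* (suc m ℕ.+ (suc m ℕ.+ suc (suc m)))

+sq : ∀ k → + sq k ≡ k ℤ.* k
+sq (+ n)    = ℤₚ.pos-* n n
+sq -[1+ n ] = ≡.refl

+oct : ∀ k → + oct k ≡ k ℤ.* (+ 3 ℤ.* k ℤ.- + 2)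
+oct (+ zero)  = ≡.refl
+oct (+ suc m) = ≡.trans (ℤₚ.pos-* (suc m) _) (eq (+ m))
  where
  eq : ∀ m → (+ 1 ℤ.+ m) ℤ.* ((+ 1 ℤ.+ m) ℤ.+ (m ℤ.+ m)) ≡
    (+ 1 ℤ.+ m) ℤ.* (+ 3 ℤ.* (+ 1 ℤ.+ m) ℤ.- + 2)
  eq = ℤ-solve
+oct -[1+ m ]  = ≡.trans (ℤₚ.pos-* (suc m) _) (eq (+ m))
  where
  eq : ∀ m → (+ 1 ℤ.+ m) ℤ.* ((+ 1 ℤ.+ m) ℤ.+ ((+ 2 ℤ.+ m) ℤ.+ (+ 2 ℤ.+ m))) ≡
    ℤ.- (+ 1 ℤ.+ m) ℤ.* (+ 3 ℤ.* ℤ.- (+ 1 ℤ.+ m) ℤ.- + 2)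
  eq = ℤ-solve

+pent : ∀ k → + pent k ≡ k ℤ.* (+ 3 ℤ.* k ℤ.- + 1)
+pent (+ zero)  = ≡.refl
+pent (+ suc m) = ≡.trans (ℤₚ.pos-* (suc m) _) (eq (+ m))
  where
  eq : ∀ m → (+ 1 ℤ.+ m) ℤ.* ((+ 1 ℤ.+ m) ℤ.+ (m ℤ.+ (+ 1 ℤ.+ m))) ≡
    (+ 1 ℤ.+ m) ℤ.* (+ 3 ℤ.* (+ 1 ℤ.+ m) ℤ.- + 1)
  eq = ℤ-solve
+pent -[1+ m ]  = ≡.trans (ℤₚ.pos-* (suc m) _) (eq (+ m))
  where
  eq : ∀ m → (+ 1 ℤ.+ m) ℤ.* ((+ 1 ℤ.+ m) ℤ.+ ((+ 1 ℤ.+ m) ℤ.+ (+ 2 ℤ.+ m))) ≡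
    ℤ.- (+ 1 ℤ.+ m) ℤ.* (+ 3 ℤ.* ℤ.- (+ 1 ℤ.+ m) ℤ.- + 1)
  eq = ℤ-solve

sq-≥ : ∀ k → ∣ k ∣ ℕ.≤ sq k
sq-≥ (+ zero)  = z≤n
sq-≥ (+ suc m) = ℕₚ.m≤m*n (suc m) (suc m)
sq-≥ -[1+ m ]  = ℕₚ.m≤m*n (suc m) (suc m)

oct-≥ : ∀ k → ∣ k ∣ ℕ.≤ oct k
oct-≥ (+ zero)  = z≤n
oct-≥ (+ suc m) = ℕₚ.m≤m*n (suc m) _
oct-≥ -[1+ m ]  = ℕₚ.m≤m*n (suc m) _

pent-≥ : ∀ k → ∣ k ∣ ℕ.≤ pent k
pent-≥ (+ zero)  = z≤n
pent-≥ (+ suc m) = ℕₚ.m≤m*n (suc m) _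
pent-≥ -[1+ m ]  = ℕₚ.m≤m*n (suc m) _

sq-3k : ∀ k → sq (+ 3 ℤ.* k) ≡ 9 ℕ.* sq k
sq-3k k = ℤₚ.+-injective (begin
  + sq (+ 3 ℤ.* k)          ≡⟨ +sq (+ 3 ℤ.* k) ⟩
  + 3 ℤ.* k ℤ.* (+ 3 ℤ.* k) ≡⟨ eq k ⟩
  + 9 ℤ.* (k ℤ.* k)         ≡⟨ ≡.cong (+ 9 ℤ.*_) (+sq k) ⟨
  + 9 ℤ.* + sq k            ≡⟨ ℤₚ.pos-* 9 (sq k) ⟨
  + (9 ℕ.* sq k)            ∎)
  where
  open ≡.≡-Reasoning
  eq : ∀ k → + 3 ℤ.* k ℤ.* (+ 3 ℤ.* k) ≡ + 9 ℤ.* (k ℤ.* k)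
  eq = ℤ-solve

-- The origin of the exponents of Ω: they are what remains of the squares prime to 3.
sq-3k-1 : ∀ k → sq (+ 3 ℤ.* k ℤ.- + 1) ≡ suc (3 ℕ.* oct k)
sq-3k-1 k = ℤₚ.+-injective (begin
  + sq (+ 3 ℤ.* k ℤ.- + 1)                        ≡⟨ +sq (+ 3 ℤ.* k ℤ.- + 1) ⟩
  (+ 3 ℤ.* k ℤ.- + 1) ℤ.* (+ 3 ℤ.* k ℤ.- + 1)     ≡⟨ eq k ⟩
  + 1 ℤ.+ + 3 ℤ.* (k ℤ.* (+ 3 ℤ.* k ℤ.- + 2))     ≡⟨ ≡.cong (λ i → + 1 ℤ.+ + 3 ℤ.* i) (+oct k) ⟨
  + 1 ℤ.+ + 3 ℤ.* + oct k                         ≡⟨ ≡.cong (λ i → + 1 ℤ.+ i) (ℤₚ.pos-* 3 (oct k)) ⟨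
  + suc (3 ℕ.* oct k)                             ∎)
  where
  open ≡.≡-Reasoning
  eq : ∀ k → (+ 3 ℤ.* k ℤ.- + 1) ℤ.* (+ 3 ℤ.* k ℤ.- + 1) ≡
    + 1 ℤ.+ + 3 ℤ.* (k ℤ.* (+ 3 ℤ.* k ℤ.- + 2))
  eq = ℤ-solve

-- With x = u - v and y = u + v the cross terms of 3x² + 3y² cancel and the linear term -2y splits,
-- so the exponent separates into a part in u and a part in v.
sq-oct-rotate : ∀ u v →
  3 ℕ.* sq (u ℤ.- v) ℕ.+ oct (u ℤ.+ v) ≡ 2 ℕ.* pent u ℕ.+ 2 ℕ.* pent v
sq-oct-rotate u v = ℤₚ.+-injective (begin
  + (3 ℕ.* sq (u ℤ.- v)) ℤ.+ + oct (u ℤ.+ v)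
    ≡⟨ ≡.cong₂ ℤ._+_ (≡.trans (ℤₚ.pos-* 3 (sq (u ℤ.- v))) (≡.cong (+ 3 ℤ.*_) (+sq (u ℤ.- v)))) (+oct (u ℤ.+ v)) ⟩
  + 3 ℤ.* ((u ℤ.- v) ℤ.* (u ℤ.- v)) ℤ.+ (u ℤ.+ v) ℤ.* (+ 3 ℤ.* (u ℤ.+ v) ℤ.- + 2)
    ≡⟨ eq u v ⟩
  + 2 ℤ.* (u ℤ.* (+ 3 ℤ.* u ℤ.- + 1)) ℤ.+ + 2 ℤ.* (v ℤ.* (+ 3 ℤ.* v ℤ.- + 1))
    ≡⟨ ≡.cong₂ ℤ._+_ (twice u) (twice v) ⟨
  + (2 ℕ.* pent u) ℤ.+ + (2 ℕ.* pent v) ∎)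
  where
  open ≡.≡-Reasoning
  twice : ∀ k → + (2 ℕ.* pent k) ≡ + 2 ℤ.* (k ℤ.* (+ 3 ℤ.* k ℤ.- + 1))
  twice k = ≡.trans (ℤₚ.pos-* 2 (pent k)) (≡.cong (+ 2 ℤ.*_) (+pent k))
  eq : ∀ u v → + 3 ℤ.* ((u ℤ.- v) ℤ.* (u ℤ.- v)) ℤ.+ (u ℤ.+ v) ℤ.* (+ 3 ℤ.* (u ℤ.+ v) ℤ.- + 2) ≡
    + 2 ℤ.* (u ℤ.* (+ 3 ℤ.* u ℤ.- + 1)) ℤ.+ + 2 ℤ.* (v ℤ.* (+ 3 ℤ.* v ℤ.- + 1))
  eq = ℤ-solve

-- Commutative rings of characteristic 3

Characteristic3 : ∀ {c ℓ} → CommutativeRing c ℓ → Set ℓ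
Characteristic3 R = 1# + (1# + 1#) ≈ 0#
  where open CommutativeRing R

module Char3 {c ℓ} (R : CommutativeRing c ℓ) (char3 : Characteristic3 R) where

  open CommutativeRing R public
  open Algebra.Properties.CommutativeSemiring.Exp commutativeSemiring public
    using (_^_; ^-congˡ; ^-homo-*; ^-assocʳ; ^-distrib-*)
  open Algebra.Properties.Ring ring
    using (-‿involutive; -0#≈0#)

  open import Relation.Binary.Reasoning.Setoid setoid

  private
    embed : F₃ → Carrier
    embed 𝟘 = 0#
    embed 𝟙 = 1#
    embed 𝟚 = 1# + 1#

    minusOne : 1# + 1# ≈ - 1#
    minusOne = begin
      1# + 1#                 ≈⟨ +-identityˡ _ ⟨
      0# + (1# + 1#)          ≈⟨ +-congʳ (-‿inverseˡ 1#) ⟨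
      (- 1# + 1#) + (1# + 1#) ≈⟨ +-assoc _ _ _ ⟩
      - 1# + (1# + (1# + 1#)) ≈⟨ +-congˡ char3 ⟩
      - 1# + 0#               ≈⟨ +-identityʳ _ ⟩
      - 1#                    ∎

    four : (1# + 1#) + (1# + 1#) ≈ 1#
    four = trans (+-assoc _ _ _) (trans (+-congˡ char3) (+-identityʳ _))

    embed-morphism : F₃-rawRing -Raw-AlmostCommutative⟶ fromCommutativeRing R
    embed-morphism = record
      { ⟦_⟧ = embed ; +-homo = +-homo ; *-homo = *-homo ; -‿homo = -‿homo
      ; 0-homo = refl ; 1-homo = refl }
      where
      open RawRing F₃-rawRing using () renaming (_+_ to _⊕_; _*_ to _⊗_; -_ to ⊖_)
      +-homo : ∀ x y → embed (x ⊕ y) ≈ embed x + embed y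
      +-homo 𝟘 y = sym (+-identityˡ _)
      +-homo 𝟙 𝟘 = sym (+-identityʳ _)
      +-homo 𝟙 𝟙 = refl
      +-homo 𝟙 𝟚 = sym char3
      +-homo 𝟚 𝟘 = sym (+-identityʳ _)
      +-homo 𝟚 𝟙 = sym (trans (+-comm _ _) char3)
      +-homo 𝟚 𝟚 = sym four
      *-homo : ∀ x y → embed (x ⊗ y) ≈ embed x * embed y
      *-homo 𝟘 y = sym (zeroˡ _)
      *-homo 𝟙 y = sym (*-identityˡ _)
      *-homo 𝟚 𝟘 = sym (zeroʳ _)
      *-homo 𝟚 𝟙 = sym (*-identityʳ _)
      *-homo 𝟚 𝟚 = sym (trans (distribˡ _ _ _) (trans (+-cong (*-identityʳ _) (*-identityʳ _)) four))
      -‿homo : ∀ x → embed (⊖ x) ≈ - embed x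
      -‿homo 𝟘 = sym -0#≈0#
      -‿homo 𝟙 = minusOne
      -‿homo 𝟚 = trans (sym (-‿involutive 1#)) (-‿cong (sym minusOne))

    _≟F_ : (x y : F₃) → Maybe (embed x ≈ embed y)
    𝟘 ≟F 𝟘 = just refl
    𝟙 ≟F 𝟙 = just refl
    𝟚 ≟F 𝟚 = just refl
    _ ≟F _ = nothing

  open Algebra.Solver.Ring F₃-rawRing (fromCommutativeRing R) embed-morphism _≟F_ public
    using (solve; _:=_; _:+_; _:*_; _:-_; :-_; _:^_; con)

  cube-+ : ∀ x y → (x + y) ^ 3 ≈ x ^ 3 + y ^ 3
  cube-+ = solve 2 (λ x y → (x :+ y) :^ 3 := x :^ 3 :+ y :^ 3) refl

  cube-- : ∀ x y → (x - y) ^ 3 ≈ x ^ 3 - y ^ 3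
  cube-- = solve 2 (λ x y → (x :- y) :^ 3 := x :^ 3 :- y :^ 3) refl

  1^ : ∀ n → 1# ^ n ≈ 1#
  1^ zero    = refl
  1^ (suc n) = trans (*-identityˡ _) (1^ n)

  ^-swap : ∀ x m n → (x ^ m) ^ n ≈ (x ^ n) ^ m
  ^-swap x m n = trans (^-assocʳ x m n)
    (trans (reflexive (≡.cong (x ^_) (ℕₚ.*-comm m n))) (sym (^-assocʳ x n m)))

  ^-≡ : ∀ x {m n} → m ≡ n → x ^ m ≈ x ^ n
  ^-≡ x e = reflexive (≡.cong (x ^_) e)

  nil-≤ : ∀ {x m n} → m ℕ.≤ n → x ^ m ≈ 0# → x ^ n ≈ 0#
  nil-≤ {x} {m} {n} m≤n x^m≈0 = begin
    x ^ n                     ≈⟨ ^-≡ x (≡.sym (ℕₚ.m+[n∸m]≡n m≤n)) ⟩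
    x ^ (m ℕ.+ (n ℕ.∸ m))     ≈⟨ ^-homo-* x m _ ⟩
    x ^ m * x ^ (n ℕ.∸ m)     ≈⟨ *-congʳ x^m≈0 ⟩
    0# * x ^ (n ℕ.∸ m)        ≈⟨ zeroˡ _ ⟩
    0#                        ∎

  nil-^ : ∀ {x m} k → x ^ m ≈ 0# → (x ^ suc k) ^ m ≈ 0#
  nil-^ {x} {m} k h = trans (^-swap x (suc k) m) (trans (*-congʳ h) (zeroˡ _))

  nil-neg : ∀ {x m} → x ^ m ≈ 0# → (- x) ^ m ≈ 0#
  nil-neg {x} {m} h = begin
    (- x) ^ m          ≈⟨ ^-congˡ m (solve 1 (λ x → :- x := :- con 𝟙 :* x) refl x) ⟩
    (- 1# * x) ^ m     ≈⟨ ^-distrib-* _ _ m ⟩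
    (- 1#) ^ m * x ^ m ≈⟨ *-congˡ h ⟩
    (- 1#) ^ m * 0#    ≈⟨ zeroʳ _ ⟩
    0#                 ∎

  Unit : Carrier → Set _
  Unit x = Σ Carrier λ y → x * y ≈ 1#

  cancelˡ : ∀ {u x y} → Unit u → u * x ≈ u * y → x ≈ y
  cancelˡ {u} {x} {y} (v , uv≈1) ux≈uy = begin
    x           ≈⟨ *-identityˡ x ⟨
    1# * x      ≈⟨ *-congʳ uv≈1 ⟨
    u * v * x   ≈⟨ solve 3 (λ u v x → u :* v :* x := v :* (u :* x)) refl u v x ⟩
    v * (u * x) ≈⟨ *-congˡ ux≈uy ⟩
    v * (u * y) ≈⟨ solve 3 (λ u v x → v :* (u :* x) := u :* v :* x) refl u v y ⟩
    u * v * y   ≈⟨ *-congʳ uv≈1 ⟩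
    1# * y      ≈⟨ *-identityˡ y ⟩
    y           ∎

  Unit-* : ∀ {x y} → Unit x → Unit y → Unit (x * y)
  Unit-* {x} {y} (x' , p) (y' , q) = x' * y' , trans
    (solve 4 (λ x y a b → x :* y :* (a :* b) := x :* a :* (y :* b)) refl x y x' y')
    (trans (*-cong p q) (*-identityˡ 1#))

  -- Cubing sends 1 - x to 1 - x³, so an inverse of 1 - x is (1 - x)² times an inverse of 1 - x³.
  -- After k cubings the argument is zero.
  1-nil-unit : ∀ k {x} → x ^ (3 ℕ.^ k) ≈ 0# → Unit (1# - x)
  1-nil-unit zero {x} h = 1# , (begin
    (1# - x) * 1#       ≈⟨ solve 1 (λ x → (con 𝟙 :- x) :* con 𝟙 := con 𝟙 :- x :^ 1) refl x ⟩
    1# - x ^ 1          ≈⟨ +-congˡ (-‿cong h) ⟩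
    1# - 0#             ≈⟨ solve 0 (con 𝟙 :- con 𝟘 := con 𝟙) refl ⟩
    1#                  ∎)
  1-nil-unit (suc k) {x} h with 1-nil-unit k {x ^ 3} (trans (^-assocʳ x 3 (3 ℕ.^ k)) h)
  ... | (v , p) = (1# - x) ^ 2 * v , trans
    (solve 2 (λ x v → (con 𝟙 :- x) :* ((con 𝟙 :- x) :^ 2 :* v) := (con 𝟙 :- x :^ 3) :* v) refl x v) p

  -- Finite products and Pochhammer symbols

  ∏ : (ℕ → Carrier) → ℕ → Carrier
  ∏ g zero    = 1#
  ∏ g (suc n) = ∏ g n * g n

  ∏-cong : ∀ {f g} → (∀ j → f j ≈ g j) → ∀ n → ∏ f n ≈ ∏ g n
  ∏-cong h zero    = refl
  ∏-cong h (suc n) = *-cong (∏-cong h n) (h n)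

  ∏-* : ∀ f g n → ∏ (λ j → f j * g j) n ≈ ∏ f n * ∏ g n
  ∏-* f g zero    = sym (*-identityˡ _)
  ∏-* f g (suc n) = trans (*-congʳ (∏-* f g n))
    (solve 4 (λ a b c d → a :* b :* (c :* d) := a :* c :* (b :* d)) refl _ _ _ _)

  ∏-^ : ∀ f k n → ∏ (λ j → f j ^ k) n ≈ ∏ f n ^ k
  ∏-^ f k zero    = sym (1^ k)
  ∏-^ f k (suc n) = trans (*-congʳ (∏-^ f k n)) (sym (^-distrib-* _ _ k))

  ∏-unit : ∀ {f} → (∀ j → Unit (f j)) → ∀ n → Unit (∏ f n)
  ∏-unit h zero    = 1# , *-identityˡ 1#
  ∏-unit h (suc n) = Unit-* (∏-unit h n) (h n)

  ∏-≥ : ∀ {f} M k → (∀ j → M ℕ.≤ j → f j ≈ 1#) → ∏ f (k ℕ.+ M) ≈ ∏ f M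
  ∏-≥ M zero    h = refl
  ∏-≥ M (suc k) h = trans (*-cong (∏-≥ M k h) (h _ (ℕₚ.m≤n+m M k))) (*-identityʳ _)

  -- (x; x)_n,  (-x; x)_n  and  (x; x²)_n
  Poch PochPlus PochOdd : Carrier → ℕ → Carrier
  Poch x     = ∏ λ j → 1# - x ^ suc j
  PochPlus x = ∏ λ j → 1# + x ^ suc j
  PochOdd x  = ∏ λ j → 1# - x ^ (j ℕ.+ suc (j ℕ.+ 0))

  Poch-cong : ∀ {x y} n → x ≈ y → Poch x n ≈ Poch y n
  Poch-cong n e = ∏-cong (λ j → +-congˡ (-‿cong (^-congˡ (suc j) e))) n

  Poch*PochPlus : ∀ x n → Poch x n * PochPlus x n ≈ Poch (x ^ 2) n
  Poch*PochPlus x n = trans (sym (∏-* _ _ n)) (∏-cong (λ j → trans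
    (solve 1 (λ y → (con 𝟙 :- y) :* (con 𝟙 :+ y) := con 𝟙 :- y :^ 2) refl (x ^ suc j))
    (+-congˡ (-‿cong (^-swap x (suc j) 2)))) n)

  -- The exponent `j + suc (j + 0)` is what `2 * suc j ∸ 1` in `factor` computes to. Keeping that
  -- form lets these products match `partialProd` definitionally.
  odd-neg : ∀ x j → (- x) ^ (j ℕ.+ suc (j ℕ.+ 0)) ≈ - (x ^ (j ℕ.+ suc (j ℕ.+ 0)))
  odd-neg x zero    = solve 1 (λ x → (:- x) :^ 1 := :- x :^ 1) refl x
  odd-neg x (suc j) = begin
    (- x) ^ suc (j ℕ.+ suc (suc (j ℕ.+ 0)))  ≈⟨ ^-≡ (- x) (≡.cong suc (ℕₚ.+-suc j _)) ⟩
    (- x) * (- x * (- x) ^ m)                ≈⟨ *-congˡ (*-congˡ (odd-neg x j)) ⟩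
    (- x) * (- x * - (x ^ m))                ≈⟨ solve 2 (λ x y → :- x :* (:- x :* :- y) := :- (x :* (x :* y))) refl x (x ^ m) ⟩
    - (x ^ suc (suc m))                      ≈⟨ -‿cong (^-≡ x (≡.cong suc (ℕₚ.+-suc j _))) ⟨
    - (x ^ suc (j ℕ.+ suc (suc (j ℕ.+ 0)))) ∎
    where
    m : ℕ
    m = j ℕ.+ suc (j ℕ.+ 0)

  PochOdd*neg : ∀ x n → PochOdd x n * PochOdd (- x) n ≈ PochOdd (x ^ 2) n
  PochOdd*neg x n = trans (sym (∏-* _ _ n)) (∏-cong factor-eq n)
    where
    factor-eq : ∀ j → let m = j ℕ.+ suc (j ℕ.+ 0) in
      (1# - x ^ m) * (1# - (- x) ^ m) ≈ 1# - (x ^ 2) ^ m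
    factor-eq j = trans (*-congˡ (+-congˡ (-‿cong (odd-neg x j)))) (trans
      (solve 1 (λ y → (con 𝟙 :- y) :* (con 𝟙 :- :- y) := con 𝟙 :- y :^ 2) refl _)
      (+-congˡ (-‿cong (^-swap x (j ℕ.+ suc (j ℕ.+ 0)) 2))))

  Poch-split : ∀ x n → Poch x (n ℕ.+ n) ≈ PochOdd x n * Poch (x ^ 2) n
  Poch-split x zero    = sym (*-identityˡ _)
  Poch-split x (suc n) = begin
    Poch x (suc n ℕ.+ suc n)                        ≈⟨ reflexive (≡.cong (Poch x) (≡.cong suc (ℕₚ.+-suc n n))) ⟩
    Poch x (n ℕ.+ n) * (1# - x ^ suc (n ℕ.+ n)) * (1# - x ^ suc (suc (n ℕ.+ n)))
      ≈⟨ *-cong (*-cong (Poch-split x n) (+-congˡ (-‿cong (^-≡ x e₁)))) (+-congˡ (-‿cong e₂)) ⟩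
    PochOdd x n * Poch (x ^ 2) n * (1# - x ^ (n ℕ.+ suc (n ℕ.+ 0))) * (1# - (x ^ 2) ^ suc n)
      ≈⟨ solve 4 (λ a b c d → a :* b :* c :* d := a :* c :* (b :* d)) refl _ _ _ _ ⟩
    PochOdd x (suc n) * Poch (x ^ 2) (suc n) ∎
    where
    e₁ : suc (n ℕ.+ n) ≡ n ℕ.+ suc (n ℕ.+ 0)
    e₁ = ≡.trans (≡.sym (ℕₚ.+-suc n n)) (≡.cong (λ k → n ℕ.+ suc k) (≡.sym (ℕₚ.+-identityʳ n)))
    e₂ : x ^ suc (suc (n ℕ.+ n)) ≈ (x ^ 2) ^ suc n
    e₂ = trans (^-≡ x (≡.trans (≡.cong suc (≡.sym (ℕₚ.+-suc n n)))
      (≡.cong (λ k → suc n ℕ.+ suc k) (≡.sym (ℕₚ.+-identityʳ n))))) (sym (^-assocʳ x 2 (suc n)))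

  Poch-cube : ∀ x n → Poch x n ^ 3 ≈ Poch (x ^ 3) n
  Poch-cube x n = trans (sym (∏-^ _ 3 n)) (∏-cong (λ j → trans (cube-- 1# _)
    (+-cong (1^ 3) (-‿cong (^-swap x (suc j) 3)))) n)

  module Nilpotent {x : Carrier} (M : ℕ) (nil : x ^ suc M ≈ 0#) where

    nil-> : ∀ {n} → M ℕ.< n → x ^ n ≈ 0#
    nil-> lt = nil-≤ lt nil

    Poch-unit : Unit (Poch x M)
    -- `n<3^n` gives M + 1 ≤ 3^M, so M cubings annihilate every power of `x` that occurs.
    Poch-unit = ∏-unit (λ j → 1-nil-unit M (nil-≤ (n<3^n M) (nil-^ {m = suc M} j nil))) M

    -- Euler: partitions into distinct parts and into odd parts.
    PochOdd*PochPlus : PochOdd x M * PochPlus x M ≈ 1#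
    PochOdd*PochPlus = cancelˡ Poch-unit (begin
      Poch x M * (PochOdd x M * PochPlus x M) ≈⟨ solve 3 (λ a b c → a :* (b :* c) := b :* (a :* c)) refl _ _ _ ⟩
      PochOdd x M * (Poch x M * PochPlus x M) ≈⟨ *-congˡ (Poch*PochPlus x M) ⟩
      PochOdd x M * Poch (x ^ 2) M            ≈⟨ Poch-split x M ⟨
      Poch x (M ℕ.+ M)                        ≈⟨ Poch-trunc ⟩
      Poch x M                                ≈⟨ *-identityʳ _ ⟨
      Poch x M * 1#                           ∎)
      where
      -- Factors whose exponent exceeds M equal 1, so M factors already stand for the infinite
      -- product.
      Poch-trunc : Poch x (M ℕ.+ M) ≈ Poch x M
      Poch-trunc = ∏-≥ M M (λ j M≤j → trans (+-congˡ (-‿cong (nil-> (s≤s M≤j))))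
        (solve 0 (con 𝟙 :- con 𝟘 := con 𝟙) refl))

    Poch≈PochOdd*Poch² : Poch x M ≈ PochOdd x M * Poch (x ^ 2) M
    Poch≈PochOdd*Poch² = begin
      Poch x M                                ≈⟨ *-identityʳ _ ⟨
      Poch x M * 1#                           ≈⟨ *-congˡ PochOdd*PochPlus ⟨
      Poch x M * (PochOdd x M * PochPlus x M) ≈⟨ solve 3 (λ a b c → a :* (b :* c) := b :* (a :* c)) refl _ _ _ ⟩
      PochOdd x M * (Poch x M * PochPlus x M) ≈⟨ *-congˡ (Poch*PochPlus x M) ⟩
      PochOdd x M * Poch (x ^ 2) M            ∎

  -- Sums over ℤ

  -- ∑ L g  =  Σ_{|k| ≤ L} g k
  ∑ : ℕ → (ℤ → Carrier) → Carrier
  ∑ zero    g = g (+ 0)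
  ∑ (suc L) g = ∑ L g + (g (+ suc L) + g -[1+ L ])

  ∑-cong-≤ : ∀ {f g} L → (∀ k → ∣ k ∣ ℕ.≤ L → f k ≈ g k) → ∑ L f ≈ ∑ L g
  ∑-cong-≤ zero    h = h (+ 0) z≤n
  ∑-cong-≤ (suc L) h = +-cong (∑-cong-≤ L λ k le → h k (ℕₚ.m≤n⇒m≤1+n le))
    (+-cong (h (+ suc L) ℕₚ.≤-refl) (h -[1+ L ] ℕₚ.≤-refl))

  ∑-cong : ∀ {f g} L → (∀ k → f k ≈ g k) → ∑ L f ≈ ∑ L g
  ∑-cong L h = ∑-cong-≤ L λ k _ → h k

  ∑-+ : ∀ f g L → ∑ L (λ k → f k + g k) ≈ ∑ L f + ∑ L g
  ∑-+ f g zero    = refl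
  ∑-+ f g (suc L) = trans (+-congʳ (∑-+ f g L))
    (solve 6 (λ a b c d e f → a :+ b :+ (c :+ d :+ (e :+ f)) := a :+ (c :+ e) :+ (b :+ (d :+ f)))
      refl _ _ _ _ _ _)

  ∑-*ˡ : ∀ a g L → ∑ L (λ k → a * g k) ≈ a * ∑ L g
  ∑-*ˡ a g zero    = refl
  ∑-*ˡ a g (suc L) = trans (+-congʳ (∑-*ˡ a g L))
    (solve 4 (λ a b c d → a :* b :+ (a :* c :+ a :* d) := a :* (b :+ (c :+ d))) refl _ _ _ _)

  ∑-*ʳ : ∀ g a L → ∑ L (λ k → g k * a) ≈ ∑ L g * a
  ∑-*ʳ g a L = trans (∑-cong L λ k → *-comm _ _) (trans (∑-*ˡ a g L) (*-comm _ _))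

  ∑-cube : ∀ g L → ∑ L (λ k → g k ^ 3) ≈ ∑ L g ^ 3
  ∑-cube g zero    = refl
  ∑-cube g (suc L) = trans (+-congʳ (∑-cube g L)) (trans
    (+-congˡ (sym (cube-+ _ _))) (sym (cube-+ _ _)))

  ∑-0 : ∀ L → ∑ L (λ _ → 0#) ≈ 0#
  ∑-0 zero    = refl
  ∑-0 (suc L) = trans (+-cong (∑-0 L) (+-identityˡ 0#)) (+-identityˡ 0#)

  ∑-swap : ∀ (f : ℤ → ℤ → Carrier) K L →
    ∑ K (λ i → ∑ L (f i)) ≈ ∑ L (λ j → ∑ K (λ i → f i j))
  ∑-swap f zero    L = refl
  ∑-swap f (suc K) L = sym (trans (∑-+ _ _ L)
    (+-cong (sym (∑-swap f K L)) (∑-+ _ _ L)))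

  ∑-neg : ∀ g L → ∑ L (λ k → g (ℤ.- k)) ≈ ∑ L g
  ∑-neg g zero    = refl
  ∑-neg g (suc L) = +-cong (∑-neg g L) (+-comm _ _)

  Supported : ℕ → (ℤ → Carrier) → Set _
  Supported B g = ∀ k → B ℕ.< ∣ k ∣ → g k ≈ 0#

  ∑-≥ : ∀ {B g L} → Supported B g → B ℕ.≤ L → ∑ L g ≈ ∑ B g
  ∑-≥ {B} {g} {L} supp B≤L = trans
    (reflexive (≡.cong (λ n → ∑ n g) (≡.sym (ℕₚ.m∸n+n≡m B≤L)))) (extend (L ℕ.∸ B))
    where
    extend : ∀ d → ∑ (d ℕ.+ B) g ≈ ∑ B g
    extend zero    = refl
    extend (suc d) = trans (+-cong (extend d) (trans (+-cong
      (supp (+ suc (d ℕ.+ B)) (s≤s (ℕₚ.m≤n+m B d)))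
      (supp -[1+ d ℕ.+ B ] (s≤s (ℕₚ.m≤n+m B d)))) (+-identityˡ 0#))) (+-identityʳ _)

  private
    suc-neg : ∀ L → ℤ.suc -[1+ L ] ≡ ℤ.- (+ L)
    suc-neg zero    = ≡.refl
    suc-neg (suc L) = ≡.refl

  -- Moving the window by one loses a term at one end and gains one at the other; each is added on
  -- the opposite side, which avoids subtraction.
  ∑-suc : ∀ g L → ∑ L (λ k → g (ℤ.suc k)) + g (ℤ.- (+ L)) ≈ ∑ L g + g (+ suc L)
  ∑-suc g zero    = +-comm _ _
  ∑-suc g (suc L) = begin
    ∑ L (λ k → g (ℤ.suc k)) + (g (+ suc (suc L)) + g (ℤ.suc -[1+ L ])) + g -[1+ L ]
      ≈⟨ +-congʳ (+-congˡ (+-congˡ (reflexive (≡.cong g (suc-neg L))))) ⟩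
    ∑ L (λ k → g (ℤ.suc k)) + (g (+ suc (suc L)) + g (ℤ.- (+ L))) + g -[1+ L ]
      ≈⟨ solve 4 (λ a b c d → a :+ (b :+ c) :+ d := (a :+ c) :+ (b :+ d)) refl _ _ _ _ ⟩
    (∑ L (λ k → g (ℤ.suc k)) + g (ℤ.- (+ L))) + (g (+ suc (suc L)) + g -[1+ L ])
      ≈⟨ +-congʳ (∑-suc g L) ⟩
    (∑ L g + g (+ suc L)) + (g (+ suc (suc L)) + g -[1+ L ])
      ≈⟨ solve 4 (λ a b c d → (a :+ b) :+ (c :+ d) := a :+ (b :+ d) :+ c) refl _ _ _ _ ⟩
    ∑ L g + (g (+ suc L) + g -[1+ L ]) + g (+ suc (suc L)) ∎

  private
    ∑-translate⁺ : ∀ {B g} → Supported B g → ∀ n L → B ℕ.+ n ℕ.≤ L →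
      ∑ L (λ k → g (+ n ℤ.+ k)) ≈ ∑ L g
    ∑-translate⁺ {g = g} supp zero L le = ∑-cong L λ k → reflexive (≡.cong g (ℤₚ.+-identityˡ k))
    ∑-translate⁺ {B} {g} supp (suc n) L le = begin
      ∑ L (λ k → g (+ suc n ℤ.+ k))
        ≈⟨ ∑-cong L (λ k → reflexive (≡.cong g (eq k))) ⟩
      ∑ L (λ k → g (+ n ℤ.+ ℤ.suc k))
        ≈⟨ +-identityʳ _ ⟨
      ∑ L (λ k → g (+ n ℤ.+ ℤ.suc k)) + 0#
        ≈⟨ +-congˡ (supp _ low) ⟨
      ∑ L (λ k → g (+ n ℤ.+ ℤ.suc k)) + g (+ n ℤ.+ ℤ.- (+ L))
        ≈⟨ ∑-suc (λ k → g (+ n ℤ.+ k)) L ⟩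
      ∑ L (λ k → g (+ n ℤ.+ k)) + g (+ (n ℕ.+ suc L))
        ≈⟨ +-congˡ (supp _ high) ⟩
      ∑ L (λ k → g (+ n ℤ.+ k)) + 0#
        ≈⟨ +-identityʳ _ ⟩
      ∑ L (λ k → g (+ n ℤ.+ k))
        ≈⟨ ∑-translate⁺ supp n L (ℕₚ.≤-trans (ℕₚ.+-monoʳ-≤ B (ℕₚ.n≤1+n n)) le) ⟩
      ∑ L g ∎
      where
      eq : ∀ k → + suc n ℤ.+ k ≡ + n ℤ.+ ℤ.suc k
      eq k = ≡.trans (≡.cong (ℤ._+ k) (≡.trans (≡.cong +_ (ℕₚ.+-comm 1 n)) (ℤₚ.pos-+ n 1)))
        (ℤₚ.+-assoc (+ n) (+ 1) k)
      le′ : suc (B ℕ.+ n) ℕ.≤ L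
      le′ = ≡.subst (ℕ._≤ L) (ℕₚ.+-suc B n) le
      low : B ℕ.< ∣ + n ℤ.+ ℤ.- (+ L) ∣
      low = ≡.subst (B ℕ.<_)
        (≡.sym (≡.trans (≡.cong ∣_∣ (ℤₚ.m-n≡m⊖n n L))
          (ℤₚ.∣⊖∣-≤ (ℕₚ.≤-trans (ℕₚ.m≤n+m n (suc B)) le′))))
        (ℕₚ.m+n≤o⇒m≤o∸n (suc B) le′)
      high : B ℕ.< n ℕ.+ suc L
      high = ℕₚ.≤-trans (s≤s (ℕₚ.≤-trans (ℕₚ.m≤m+n B n) (ℕₚ.≤-trans (ℕₚ.n≤1+n _) le′)))
        (ℕₚ.m≤n+m (suc L) n)

  -- The bound on `L` keeps the whole support inside the window before and after the shift, so that
  -- each unit step exchanges only zero terms. Negative shifts reduce to positive ones by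
  -- reflection.
  ∑-translate : ∀ {B g} → Supported B g → ∀ j L → B ℕ.+ ∣ j ∣ ℕ.≤ L →
    ∑ L (λ k → g (j ℤ.+ k)) ≈ ∑ L g
  ∑-translate supp (+ n) L le = ∑-translate⁺ supp n L le
  ∑-translate {B} {g} supp -[1+ n ] L le = begin
    ∑ L (λ k → g (-[1+ n ] ℤ.+ k))         ≈⟨ ∑-neg _ L ⟨
    ∑ L (λ k → g (-[1+ n ] ℤ.+ ℤ.- k))     ≈⟨ ∑-cong L (λ k → reflexive (≡.cong g (≡.sym (ℤₚ.neg-distrib-+ (+ suc n) k)))) ⟩
    ∑ L (λ k → g (ℤ.- (+ suc n ℤ.+ k)))    ≈⟨ ∑-translate⁺ {B} {λ k → g (ℤ.- k)} (λ k lt → supp (ℤ.- k) (≡.subst (B ℕ.<_) (≡.sym (ℤₚ.∣-i∣≡∣i∣ k)) lt)) (suc n) L le ⟩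
    ∑ L (λ k → g (ℤ.- k))                  ≈⟨ ∑-neg g L ⟩
    ∑ L g                                  ∎

  ∑-even : ∀ {h} → (∀ k → h (+ 1 ℤ.+ (k ℤ.+ k)) ≈ 0#) →
    ∀ L → ∑ (double L) h ≈ ∑ L (λ k → h (k ℤ.+ k))
  ∑-even odd≈0 zero = refl
  ∑-even {h} odd≈0 (suc L) = begin
    ∑ (double L) h + (h (+ suc (double L)) + h -[1+ double L ])
      + (h (+ suc (suc (double L))) + h -[1+ suc (double L) ])
      ≈⟨ +-cong (+-cong (∑-even odd≈0 L) (+-cong
           (trans (reflexive (≡.cong (λ n → h (+ suc n)) (double≡ L))) (odd≈0 (+ L)))
           (trans (reflexive (≡.cong (λ n → h -[1+ n ]) (double≡ L))) (odd≈0 -[1+ L ]))))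
         (+-cong
           (reflexive (≡.cong (λ n → h (+ suc n)) (≡.trans (≡.cong suc (double≡ L)) (≡.sym (ℕₚ.+-suc L L)))))
           (reflexive (≡.cong (λ n → h -[1+ suc n ]) (double≡ L)))) ⟩
    ∑ L (λ k → h (k ℤ.+ k)) + (0# + 0#) + (h (+ suc L ℤ.+ + suc L) + h (-[1+ L ] ℤ.+ -[1+ L ]))
      ≈⟨ +-congʳ (trans (+-congˡ (+-identityˡ 0#)) (+-identityʳ _)) ⟩
    ∑ L (λ k → h (k ℤ.+ k)) + (h (+ suc L ℤ.+ + suc L) + h (-[1+ L ] ℤ.+ -[1+ L ])) ∎

  -- The radius 3L + 1 makes the three residue classes fit exactly: 6L + 3 indices, 2L + 1 in each
  -- class.
  ∑-thirds : ∀ h L → ∑ (suc (triple L)) h ≈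
    ∑ L (λ k → h (+ 3 ℤ.* k)) +
      (∑ L (λ k → h (+ 3 ℤ.* k ℤ.+ + 1)) + ∑ L (λ k → h (+ 3 ℤ.* k ℤ.- + 1)))
  ∑-thirds h zero = refl
  ∑-thirds h (suc L) = begin
    ∑ (suc (triple L)) h + (h (+ (2 ℕ.+ t)) + h (ℤ.- (+ (2 ℕ.+ t))))
      + (h (+ (3 ℕ.+ t)) + h (ℤ.- (+ (3 ℕ.+ t)))) + (h (+ (4 ℕ.+ t)) + h (ℤ.- (+ (4 ℕ.+ t))))
      ≈⟨ +-cong (+-cong (+-cong (∑-thirds h L)
           (+-cong (at p2) (at n2)))
           (+-cong (at p3) (at n3)))
           (+-cong (at p4) (at n4)) ⟩
    -- The six new indices ±(3K - 1), ±3K, ±(3K + 1) change class with their sign: -(3K - 1) is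
    -- 3(-K) + 1, and -(3K + 1) is 3(-K) - 1.
    (S₀ + (S₁ + S₂)) + (h (+ 3 ℤ.* K ℤ.- + 1) + h (+ 3 ℤ.* (ℤ.- K) ℤ.+ + 1))
      + (h (+ 3 ℤ.* K) + h (+ 3 ℤ.* (ℤ.- K)))
      + (h (+ 3 ℤ.* K ℤ.+ + 1) + h (+ 3 ℤ.* (ℤ.- K) ℤ.- + 1))
      ≈⟨ solve 9 (λ a b c d e f g h i → a :+ (b :+ c) :+ (d :+ e) :+ (f :+ g) :+ (h :+ i)
           := a :+ (f :+ g) :+ (b :+ (h :+ e) :+ (c :+ (d :+ i)))) refl _ _ _ _ _ _ _ _ _ ⟩
    _ ∎
    where
    t : ℕ
    t = triple L
    K : ℤ
    K = + suc L
    S₀ S₁ S₂ : Carrier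
    S₀ = ∑ L (λ k → h (+ 3 ℤ.* k))
    S₁ = ∑ L (λ k → h (+ 3 ℤ.* k ℤ.+ + 1))
    S₂ = ∑ L (λ k → h (+ 3 ℤ.* k ℤ.- + 1))
    at : ∀ {j k} → j ≡ k → h j ≈ h k
    at e = reflexive (≡.cong h e)
    +t : + t ≡ + L ℤ.+ (+ L ℤ.+ + L)
    +t = ≡.cong +_ (triple≡ L)
    ts : ∀ m → + (m ℕ.+ t) ≡ + m ℤ.+ (+ L ℤ.+ (+ L ℤ.+ + L))
    ts m = ≡.trans (ℤₚ.pos-+ m t) (≡.cong (λ i → + m ℤ.+ i) +t)
    p2 : + (2 ℕ.+ t) ≡ + 3 ℤ.* K ℤ.- + 1
    p2 = ≡.trans (ts 2) (eq (+ L))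
      where
      eq : ∀ l → + 2 ℤ.+ (l ℤ.+ (l ℤ.+ l)) ≡ + 3 ℤ.* (+ 1 ℤ.+ l) ℤ.- + 1
      eq = ℤ-solve
    n2 : ℤ.- (+ (2 ℕ.+ t)) ≡ + 3 ℤ.* (ℤ.- K) ℤ.+ + 1
    n2 = ≡.trans (≡.cong ℤ.-_ (ts 2)) (eq (+ L))
      where
      eq : ∀ l → ℤ.- (+ 2 ℤ.+ (l ℤ.+ (l ℤ.+ l))) ≡ + 3 ℤ.* (ℤ.- (+ 1 ℤ.+ l)) ℤ.+ + 1
      eq = ℤ-solve
    p3 : + (3 ℕ.+ t) ≡ + 3 ℤ.* K
    p3 = ≡.trans (ts 3) (eq (+ L))
      where
      eq : ∀ l → + 3 ℤ.+ (l ℤ.+ (l ℤ.+ l)) ≡ + 3 ℤ.* (+ 1 ℤ.+ l)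
      eq = ℤ-solve
    n3 : ℤ.- (+ (3 ℕ.+ t)) ≡ + 3 ℤ.* (ℤ.- K)
    n3 = ≡.trans (≡.cong ℤ.-_ (ts 3)) (eq (+ L))
      where
      eq : ∀ l → ℤ.- (+ 3 ℤ.+ (l ℤ.+ (l ℤ.+ l))) ≡ + 3 ℤ.* (ℤ.- (+ 1 ℤ.+ l))
      eq = ℤ-solve
    p4 : + (4 ℕ.+ t) ≡ + 3 ℤ.* K ℤ.+ + 1
    p4 = ≡.trans (ts 4) (eq (+ L))
      where
      eq : ∀ l → + 4 ℤ.+ (l ℤ.+ (l ℤ.+ l)) ≡ + 3 ℤ.* (+ 1 ℤ.+ l) ℤ.+ + 1
      eq = ℤ-solve
    n4 : ℤ.- (+ (4 ℕ.+ t)) ≡ + 3 ℤ.* (ℤ.- K) ℤ.- + 1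
    n4 = ≡.trans (≡.cong ℤ.-_ (ts 4)) (eq (+ L))
      where
      eq : ∀ l → ℤ.- (+ 4 ℤ.+ (l ℤ.+ (l ℤ.+ l))) ≡ + 3 ℤ.* (ℤ.- (+ 1 ℤ.+ l)) ℤ.- + 1
      eq = ℤ-solve

  -- The substitution x = u - v, y = u + v has as image the sublattice x ≡ y mod 2, to which the
  -- vanishing on odd differences confines `K`. It is made in two one-dimensional moves: y = x + 2v
  -- inside each row, then x = u - v inside each column. The support bounds absorb the change of
  -- window in each move.
  ∑∑-lattice : ∀ {B} (K F : ℤ → ℤ → Carrier) →
    (∀ x y → B ℕ.< ∣ x ∣ → K x y ≈ 0#) → (∀ x y → B ℕ.< ∣ y ∣ → K x y ≈ 0#) →
    (∀ x k → K x (x ℤ.+ (+ 1 ℤ.+ (k ℤ.+ k))) ≈ 0#) →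
    (∀ u v → B ℕ.< ∣ u ∣ → F u v ≈ 0#) → (∀ u v → B ℕ.< ∣ v ∣ → F u v ≈ 0#) →
    (∀ u v → K (u ℤ.- v) (u ℤ.+ v) ≈ F u v) →
    ∑ B (λ x → ∑ B (K x)) ≈ ∑ B (λ u → ∑ B (F u))
  ∑∑-lattice {B} K F K-x K-y K-odd F-u F-v K≈F = begin
    ∑ B (λ x → ∑ B (K x))
      ≈⟨ ∑-cong-≤ B row ⟩
    ∑ B (λ x → ∑ L (λ v → K x (x ℤ.+ (v ℤ.+ v))))
      ≈⟨ ∑-swap _ B L ⟩
    ∑ L (λ v → ∑ B (λ x → K x (x ℤ.+ (v ℤ.+ v))))
      ≈⟨ ∑-cong-≤ L column ⟩
    ∑ L (λ v → ∑ B (λ u → F u v))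
      ≈⟨ ∑-≥ (λ v lt → trans (∑-cong B λ u → F-v u v lt) (∑-0 B)) B≤L ⟩
    ∑ B (λ v → ∑ B (λ u → F u v))
      ≈⟨ ∑-swap F B B ⟨
    ∑ B (λ u → ∑ B (F u)) ∎
    where
    L : ℕ
    L = B ℕ.+ B
    B≤L : B ℕ.≤ L
    B≤L = ℕₚ.m≤m+n B B
    L≤2L : L ℕ.≤ double L
    L≤2L = ≡.subst (L ℕ.≤_) (≡.sym (double≡ L)) (ℕₚ.m≤m+n L L)
    row : ∀ x → ∣ x ∣ ℕ.≤ B → ∑ B (K x) ≈ ∑ L (λ v → K x (x ℤ.+ (v ℤ.+ v)))
    row x le = begin
      ∑ B (K x)                         ≈⟨ ∑-≥ (K-y x) (ℕₚ.≤-trans B≤L L≤2L) ⟨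
      ∑ (double L) (K x)                ≈⟨ ∑-translate (K-y x) x (double L)
                                             (ℕₚ.≤-trans (ℕₚ.+-monoʳ-≤ B le) L≤2L) ⟨
      ∑ (double L) (λ w → K x (x ℤ.+ w)) ≈⟨ ∑-even (K-odd x) L ⟩
      ∑ L (λ v → K x (x ℤ.+ (v ℤ.+ v))) ∎
    column : ∀ v → ∣ v ∣ ℕ.≤ L →
      ∑ B (λ x → K x (x ℤ.+ (v ℤ.+ v))) ≈ ∑ B (λ u → F u v)
    column v le = begin
      ∑ B g                               ≈⟨ ∑-≥ supp (ℕₚ.≤-trans B≤L L≤2L) ⟨
      ∑ (double L) g                      ≈⟨ ∑-translate supp (ℤ.- v) (double L) bound ⟨
      ∑ (double L) (λ u → g (ℤ.- v ℤ.+ u)) ≈⟨ ∑-cong (double L) (λ u → trans (reflexive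
                                               (≡.cong₂ K (ℤₚ.+-comm (ℤ.- v) u) (eq u v))) (K≈F u v)) ⟩
      ∑ (double L) (λ u → F u v)          ≈⟨ ∑-≥ (λ u → F-u u v) (ℕₚ.≤-trans B≤L L≤2L) ⟩
      ∑ B (λ u → F u v)                   ∎
      where
      g : ℤ → Carrier
      g x = K x (x ℤ.+ (v ℤ.+ v))
      supp : Supported B g
      supp x = K-x x _
      bound : B ℕ.+ ∣ ℤ.- v ∣ ℕ.≤ double L
      bound = ≡.subst₂ (λ a b → B ℕ.+ a ℕ.≤ b) (≡.sym (ℤₚ.∣-i∣≡∣i∣ v)) (≡.sym (double≡ L))
        (ℕₚ.+-mono-≤ B≤L le)
      eq : ∀ u v → ℤ.- v ℤ.+ u ℤ.+ (v ℤ.+ v) ≡ u ℤ.+ v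
      eq = ℤ-solve

  -- Powers of minus one

  -1^_ : ℕ → Carrier
  -1^ n = (- 1#) ^ n

  -1^-cases : ∀ n → (-1^ n ≈ 1#) ⊎ (-1^ n ≈ - 1#)
  -1^-cases zero = inj₁ refl
  -1^-cases (suc n) with -1^-cases n
  ... | inj₁ e = inj₂ (trans (*-congˡ e) (*-identityʳ _))
  ... | inj₂ e = inj₁ (trans (*-congˡ e) (solve 0 (:- con 𝟙 :* :- con 𝟙 := con 𝟙) refl))

  -1^-square : ∀ n → -1^ n * -1^ n ≈ 1#
  -1^-square n with -1^-cases n
  ... | inj₁ e = trans (*-cong e e) (*-identityˡ 1#)
  ... | inj₂ e = trans (*-cong e e) (solve 0 (:- con 𝟙 :* :- con 𝟙 := con 𝟙) refl)

  -1^-even : ∀ n → -1^ (n ℕ.+ n) ≈ 1#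
  -1^-even n = trans (^-homo-* _ n n) (-1^-square n)

  -1^-+even : ∀ m n → -1^ (m ℕ.+ (n ℕ.+ n)) ≈ -1^ m
  -1^-+even m n = trans (^-homo-* _ m (n ℕ.+ n)) (trans (*-congˡ (-1^-even n)) (*-identityʳ _))

  -- A product of two numbers of equal parity has that parity. This is the shape of the exponents
  -- `sq` and `oct`.
  -1^-* : ∀ m n → -1^ m ≈ -1^ n → -1^ (m ℕ.* n) ≈ -1^ m
  -1^-* m n h with -1^-cases m
  ... | inj₁ e = trans (sym (^-assocʳ _ m n)) (trans (^-congˡ n e) (trans (1^ n) (sym e)))
  ... | inj₂ e = trans (sym (^-assocʳ _ m n)) (trans (^-congˡ n e) (sym h))

  neg-^ : ∀ x n → (- x) ^ n ≈ -1^ n * x ^ n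
  neg-^ x n = trans (^-congˡ n (solve 1 (λ x → :- x := :- con 𝟙 :* x) refl x)) (^-distrib-* _ _ n)

  sgn : ℤ → Carrier
  sgn k = -1^ ∣ k ∣

  sgn² : ∀ k → sgn k * sgn k ≈ 1#
  sgn² k = -1^-square ∣ k ∣

  sgn-neg : ∀ k → sgn (ℤ.- k) ≈ sgn k
  sgn-neg k = ^-≡ _ (ℤₚ.∣-i∣≡∣i∣ k)

  sgn-⊖ : ∀ m n → sgn (m ℤ.⊖ n) ≈ -1^ m * -1^ n
  sgn-⊖ zero    zero    = sym (*-identityˡ 1#)
  sgn-⊖ zero    (suc n) = sym (*-identityˡ _)
  sgn-⊖ (suc m) zero    = sym (*-identityʳ _)
  sgn-⊖ (suc m) (suc n) = begin
    sgn (suc m ℤ.⊖ suc n)                ≈⟨ reflexive (≡.cong sgn (ℤₚ.[1+m]⊖[1+n]≡m⊖n m n)) ⟩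
    sgn (m ℤ.⊖ n)                        ≈⟨ sgn-⊖ m n ⟩
    -1^ m * -1^ n                        ≈⟨ solve 2 (λ a b → a :* b := :- con 𝟙 :* a :* (:- con 𝟙 :* b)) refl _ _ ⟩
    -1^ suc m * -1^ suc n                ∎

  sgn-+ : ∀ j k → sgn (j ℤ.+ k) ≈ sgn j * sgn k
  sgn-+ (+ m)    (+ n)    = ^-homo-* _ m n
  sgn-+ (+ m)    -[1+ n ] = sgn-⊖ m (suc n)
  sgn-+ -[1+ m ] (+ n)    = trans (sgn-⊖ n (suc m)) (*-comm _ _)
  sgn-+ -[1+ m ] -[1+ n ] = trans (^-≡ _ (≡.cong suc (≡.sym (ℕₚ.+-suc m n)))) (^-homo-* _ (suc m) (suc n))

  sgn-sub : ∀ j k → sgn (j ℤ.- k) ≈ sgn j * sgn k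
  sgn-sub j k = trans (sgn-+ j (ℤ.- k)) (*-congˡ (sgn-neg k))

  sgn-3* : ∀ k → sgn (+ 3 ℤ.* k) ≈ sgn k
  sgn-3* k = begin
    sgn (+ 3 ℤ.* k)               ≈⟨ reflexive (≡.cong sgn (eq k)) ⟩
    sgn (k ℤ.+ (k ℤ.+ k))         ≈⟨ trans (sgn-+ k _) (*-congˡ (sgn-+ k k)) ⟩
    sgn k * (sgn k * sgn k)       ≈⟨ trans (*-congˡ (sgn² k)) (*-identityʳ _) ⟩
    sgn k                         ∎
    where
    eq : ∀ k → + 3 ℤ.* k ≡ k ℤ.+ (k ℤ.+ k)
    eq = ℤ-solve

  -1^-sq : ∀ k → -1^ sq k ≈ sgn k
  -1^-sq k = -1^-* ∣ k ∣ ∣ k ∣ refl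

  -- In `oct` the second factor is written as `∣ k ∣` plus twice a number, which shows that both
  -- factors have the same parity.
  -1^-oct : ∀ k → -1^ oct k ≈ sgn k
  -1^-oct (+ zero)  = refl
  -1^-oct (+ suc m) = -1^-* (suc m) (suc m ℕ.+ (m ℕ.+ m)) (sym (-1^-+even (suc m) m))
  -1^-oct -[1+ m ]  = -1^-* (suc m) (suc m ℕ.+ (suc (suc m) ℕ.+ suc (suc m)))
    (sym (-1^-+even (suc m) (suc (suc m))))

  -- The theorems of Euler and Gauss

  module Shanks (x : Carrier) (h : ℕ → Carrier) where

    -- (x^{s+1}; x)_d
    Q : ℕ → ℕ → Carrier
    Q s = ∏ λ j → 1# - x ^ suc (s ℕ.+ j)

    -- Shanks's sum  Σ_{r = s}^{s + d} h_r (x)_{s+d} / (x)_r · x^{r e}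
    T : ℕ → ℕ → ℕ → Carrier
    T e s zero    = h s * x ^ (s ℕ.* e)
    T e s (suc d) = h s * Q s (suc d) * x ^ (s ℕ.* e) + T e (suc s) d

    Q-head : ∀ s d → Q s (suc d) ≈ (1# - x ^ suc s) * Q (suc s) d
    Q-head s zero    = trans (*-comm _ _) (*-congʳ (+-congˡ (-‿cong (^-≡ x (≡.cong suc (ℕₚ.+-identityʳ s))))))
    Q-head s (suc d) = begin
      Q s (suc d) * (1# - x ^ suc (s ℕ.+ suc d))
        ≈⟨ *-cong (Q-head s d) (+-congˡ (-‿cong (^-≡ x (≡.cong suc (ℕₚ.+-suc s d))))) ⟩
      (1# - x ^ suc s) * Q (suc s) d * (1# - x ^ suc (suc s ℕ.+ d))
        ≈⟨ *-assoc _ _ _ ⟩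
      (1# - x ^ suc s) * Q (suc s) (suc d) ∎

    T-tail≈0 : ∀ {e s} → (∀ r → s ℕ.≤ r → h r * x ^ (r ℕ.* e) ≈ 0#) → ∀ d → T e s d ≈ 0#
    T-tail≈0 {s = s} small zero    = small s ℕₚ.≤-refl
    T-tail≈0 {e} {s} small (suc d) = trans (+-cong
      (trans (solve 3 (λ a b c → a :* b :* c := b :* (a :* c)) refl (h s) (Q s (suc d)) (x ^ (s ℕ.* e)))
        (trans (*-congˡ (small s ℕₚ.≤-refl)) (zeroʳ _)))
      (T-tail≈0 (λ r le → small r (ℕₚ.<⇒≤ le)) d)) (+-identityˡ 0#)

    -- step makes T (e + 1) - (1 + ε x^n) T e telescope; it can be met for
    -- ε = 1, e = n (Gauss) and for ε = 0, e = n - 1 (Euler).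
    module _ (ε : Carrier) (e n : ℕ)
      (step : ∀ s → h (suc s) * x ^ e ≈ - (h s * (x ^ n * (ε + x ^ s)))) where

      private
        step′ : ∀ s → h (suc s) * x ^ (suc s ℕ.* e) ≈
          - (h s * (x ^ n * (ε + x ^ s))) * x ^ (s ℕ.* e)
        step′ s = trans (*-congˡ (^-homo-* x e (s ℕ.* e)))
          (trans (sym (*-assoc _ _ _)) (*-congʳ (step s)))

        x^s*e : ∀ s → x ^ (s ℕ.* suc e) ≈ x ^ s * x ^ (s ℕ.* e)
        x^s*e s = trans (^-≡ x (ℕₚ.*-suc s e)) (^-homo-* x s (s ℕ.* e))

      -- Induction on `d` with `n` fixed, hence downwards on the lower limit `s`. The last bracket
      -- is the boundary of the telescoping: the contribution of the upper end r = n minus that of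
      -- the lower end r = s. The hypothesis `step` rewrites the lower end at s + 1 in terms of
      -- `h s`, which is what the new summand needs.
      T-step : ∀ d s → suc (s ℕ.+ d) ≡ n →
        T (suc e) s (suc d) ≈ (1# + ε * x ^ n) * T e s d +
          (h n * x ^ (n ℕ.* e) * (1# + x ^ n) - h s * Q s d * (1# - x ^ s) * x ^ (s ℕ.* e))
      T-step zero s ≡.refl = begin
        h s * (1# * (1# - X)) * x ^ (s ℕ.* suc e) + h (suc s) * x ^ (suc s ℕ.* suc e)
          ≈⟨ +-cong (*-congˡ (x^s*e s)) (*-congˡ (trans (x^s*e (suc s)) (*-congʳ X≈))) ⟩
        h s * (1# * (1# - X)) * (S * W) + h (suc s) * (X * x ^ (suc s ℕ.* e))
          ≈⟨ solve 6 (λ a X S W b V → a :* (con 𝟙 :* (con 𝟙 :- X)) :* (S :* W) :+ b :* (X :* V)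
               := a :* (con 𝟙 :* (con 𝟙 :- X)) :* (S :* W) :+ b :* V :* X)
               refl (h s) X S W (h (suc s)) (x ^ (suc s ℕ.* e)) ⟩
        h s * (1# * (1# - X)) * (S * W) + B * X
          ≈⟨ +-congˡ (*-congʳ B≈) ⟩
        h s * (1# * (1# - X)) * (S * W) + - (h s * (X * (ε + S))) * W * X
          ≈⟨ solve 5 (λ a X S W ε → a :* (con 𝟙 :* (con 𝟙 :- X)) :* (S :* W) :+ :- (a :* (X :* (ε :+ S))) :* W :* X
               := (con 𝟙 :+ ε :* X) :* (a :* W) :+
                  (:- (a :* (X :* (ε :+ S))) :* W :* (con 𝟙 :+ X) :- a :* con 𝟙 :* (con 𝟙 :- S) :* W))
               refl (h s) X S W ε ⟩
        (1# + ε * X) * (h s * W) + (- (h s * (X * (ε + S))) * W * (1# + X) - h s * 1# * (1# - S) * W)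
          ≈⟨ +-congˡ (+-congʳ (*-congʳ (trans (sym B≈) (reflexive (≡.cong (λ m → h (suc m) * x ^ (suc m ℕ.* e)) (≡.sym (ℕₚ.+-identityʳ s))))))) ⟩
        (1# + ε * X) * (h s * W) + (h n * x ^ (n ℕ.* e) * (1# + X) - h s * 1# * (1# - S) * W) ∎
        where
        X S W B : Carrier
        X = x ^ n
        S = x ^ s
        W = x ^ (s ℕ.* e)
        B = h (suc s) * x ^ (suc s ℕ.* e)
        X≈ : x ^ suc s ≈ X
        X≈ = ^-≡ x (≡.cong suc (≡.sym (ℕₚ.+-identityʳ s)))
        B≈ : B ≈ - (h s * (X * (ε + S))) * W
        B≈ = step′ s
      T-step (suc d) s ≡.refl = begin
        h s * (Q s (suc d) * (1# - X)) * x ^ (s ℕ.* suc e) + T (suc e) (suc s) (suc d)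
          ≈⟨ +-cong (*-congˡ (x^s*e s)) (T-step d (suc s) (≡.cong suc (≡.sym (ℕₚ.+-suc s d)))) ⟩
        h s * (Q s (suc d) * (1# - X)) * (S * W) +
          ((1# + ε * X) * T′ + (C - h (suc s) * Q (suc s) d * (1# - x ^ suc s) * V))
          ≈⟨ +-congˡ (+-congˡ (+-congˡ (-‿cong last-term))) ⟩
        h s * (Q s (suc d) * (1# - X)) * (S * W) +
          ((1# + ε * X) * T′ + (C - - (h s * (X * (ε + S))) * W * Q s (suc d)))
          ≈⟨ solve 8 (λ a q X S W ε T C →
               a :* (q :* (con 𝟙 :- X)) :* (S :* W) :+
                 ((con 𝟙 :+ ε :* X) :* T :+ (C :- :- (a :* (X :* (ε :+ S))) :* W :* q))
               := (con 𝟙 :+ ε :* X) :* (a :* q :* W :+ T) :+ (C :- a :* q :* (con 𝟙 :- S) :* W))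
               refl (h s) (Q s (suc d)) X S W ε T′ C ⟩
        (1# + ε * X) * (h s * Q s (suc d) * W + T′) + (C - h s * Q s (suc d) * (1# - S) * W) ∎
        where
        X S W V C T′ : Carrier
        X = x ^ n
        S = x ^ s
        W = x ^ (s ℕ.* e)
        V = x ^ (suc s ℕ.* e)
        C = h n * x ^ (n ℕ.* e) * (1# + X)
        T′ = T e (suc s) d
        last-term : h (suc s) * Q (suc s) d * (1# - x ^ suc s) * V ≈ - (h s * (X * (ε + S))) * W * Q s (suc d)
        last-term = begin
          h (suc s) * Q (suc s) d * (1# - x ^ suc s) * V
            ≈⟨ solve 4 (λ b q y V → b :* q :* y :* V := b :* V :* (y :* q)) refl
                 (h (suc s)) (Q (suc s) d) (1# - x ^ suc s) V ⟩
          h (suc s) * V * ((1# - x ^ suc s) * Q (suc s) d)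
            ≈⟨ *-cong (step′ s) (sym (Q-head s d)) ⟩
          - (h s * (X * (ε + S))) * W * Q s (suc d) ∎

      -- At s = 0 the lower boundary carries the factor 1 - x^0 = 0 and only the upper one survives.
      T-recurrence : ∀ d → suc d ≡ n →
        T (suc e) 0 (suc d) ≈ (1# + ε * x ^ n) * T e 0 d + h n * x ^ (n ℕ.* e) * (1# + x ^ n)
      T-recurrence d eq = trans (T-step d 0 eq)
        (+-congˡ (solve 2 (λ a b → a :- b :* (con 𝟙 :- con 𝟙) :* con 𝟙 := a) refl _ _))

  gauss-partial : Carrier → ℕ → Carrier
  gauss-partial x L = ∑ L λ k → sgn k * x ^ sq k

  euler-partial : Carrier → ℕ → Carrier
  euler-partial y L = ∑ L λ k → sgn k * y ^ pent k

  module _ (x : Carrier) where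

    private
      h : ℕ → Carrier
      h zero    = 1#
      h (suc s) = - (h s * (1# + x ^ s))

      -- The first factor 1 + x^0 of the product is 2; together with one sign it gives -2 = 1.
      h-suc : ∀ s → h (suc s) ≈ -1^ s * PochPlus x s
      h-suc zero    = solve 0 (:- (con 𝟙 :* (con 𝟙 :+ con 𝟙)) := con 𝟙 :* con 𝟙) refl
      h-suc (suc s) = trans (-‿cong (*-congʳ (h-suc s)))
        (solve 3 (λ a b c → :- (a :* b :* c) := :- con 𝟙 :* a :* (b :* c)) refl _ _ _)

      open Shanks x h

      -- A finite form of Gauss's theorem. The recurrence with ε = 1 and e = n = d + 1 multiplies by
      -- 1 + x^(d+1), the next factor of `PochPlus`, and its boundary term supplies k = d + 1 and k
      -- = -(d + 1) together, as their joint coefficient -2 is 1.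
      T≈partial : ∀ d → T (suc d) 0 d ≈ PochPlus x d * gauss-partial x d
      T≈partial zero    = *-congˡ (sym (*-identityˡ 1#))
      T≈partial (suc d) = begin
        T (suc (suc d)) 0 (suc d)
          ≈⟨ T-recurrence 1# (suc d) (suc d) (λ s → solve 4 (λ a b y z → :- (a :* (con 𝟙 :+ y)) :* z
               := :- (a :* (z :* (con 𝟙 :+ y)))) refl (h s) 1# (x ^ s) (x ^ suc d)) d ≡.refl ⟩
        (1# + 1# * X) * T (suc d) 0 d + h (suc d) * Y * (1# + X)
          ≈⟨ +-cong (*-congˡ (T≈partial d)) (*-congʳ (*-congʳ (h-suc d))) ⟩
        (1# + 1# * X) * (PochPlus x d * gauss-partial x d) + -1^ d * PochPlus x d * Y * (1# + X)
          ≈⟨ solve 5 (λ X R θ s Y → (con 𝟙 :+ con 𝟙 :* X) :* (R :* θ) :+ s :* R :* Y :* (con 𝟙 :+ X)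
               := R :* (con 𝟙 :+ X) :* (θ :+ (:- con 𝟙 :* s :* Y :+ :- con 𝟙 :* s :* Y)))
               refl X (PochPlus x d) (gauss-partial x d) (-1^ d) Y ⟩
        PochPlus x (suc d) * gauss-partial x (suc d) ∎
        where
        X Y : Carrier
        X = x ^ suc d
        Y = x ^ (suc d ℕ.* suc d)

    -- In `T (suc M) 0 M` every term with r ≥ 1 carries x^(r(M+1)) = 0. The term r = 0 is
    -- `Poch x M`.
    gauss : ∀ M → x ^ suc M ≈ 0# → PochPlus x M * gauss-partial x M ≈ Poch x M
    gauss M nil = trans (sym (T≈partial M)) (T≈Poch M nil)
      where
      T≈Poch : ∀ M → x ^ suc M ≈ 0# → T (suc M) 0 M ≈ Poch x M
      T≈Poch zero    nil = *-identityˡ 1#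
      T≈Poch (suc M) nil = trans (+-cong
        (solve 1 (λ p → con 𝟙 :* p :* con 𝟙 := p) refl (Poch x (suc M)))
        (T-tail≈0 small M)) (+-identityʳ _)
        where
        small : ∀ r → 1 ℕ.≤ r → h r * x ^ (r ℕ.* suc (suc M)) ≈ 0#
        small (suc r) (s≤s z≤n) = trans
          (*-congˡ (nil-≤ (ℕₚ.m≤n*m (suc (suc M)) (suc r)) nil)) (zeroʳ _)

  module _ (y : Carrier) where

    private
      x : Carrier
      -- A square root of the base, so that the pentagonal numbers k(3k - 1)/2 appear as `pent`
      -- without halving.
      x = y ^ 2

      h : ℕ → Carrier
      h zero    = 1#
      h (suc s) = - (h s * x ^ suc s)

      h≈ : ∀ s → h s ≈ -1^ s * y ^ (s ℕ.* suc s)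
      h≈ zero    = sym (*-identityˡ 1#)
      h≈ (suc s) = begin
        - (h s * x ^ suc s)
          ≈⟨ -‿cong (*-cong (h≈ s) (^-assocʳ y 2 (suc s))) ⟩
        - (-1^ s * y ^ (s ℕ.* suc s) * y ^ (2 ℕ.* suc s))
          ≈⟨ solve 3 (λ a b c → :- (a :* b :* c) := :- con 𝟙 :* a :* (b :* c)) refl _ _ _ ⟩
        -1^ suc s * (y ^ (s ℕ.* suc s) * y ^ (2 ℕ.* suc s))
          ≈⟨ *-congˡ (trans (sym (^-homo-* y (s ℕ.* suc s) (2 ℕ.* suc s))) (^-≡ y (eq s))) ⟩
        -1^ suc s * y ^ (suc s ℕ.* suc (suc s)) ∎
        where
        eq : ∀ s → s ℕ.* suc s ℕ.+ 2 ℕ.* suc s ≡ suc s ℕ.* suc (suc s)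
        eq = ℕ-solve

      open Shanks x h

      -- With ε = 0, e = d and n = d + 1 the recurrence merely adds its boundary term, whose factor
      -- 1 + x^(d+1) yields the terms k = d + 1 and k = -(d + 1) of the pentagonal series.
      T≈partial : ∀ d → T d 0 d ≈ euler-partial y d
      T≈partial zero    = refl
      T≈partial (suc d) = begin
        T (suc d) 0 (suc d)
          ≈⟨ T-recurrence 0# d (suc d) (λ s → solve 4 (λ a x y z → :- (a :* (x :* y)) :* z
               := :- (a :* (x :* z :* (con 𝟘 :+ y)))) refl (h s) x (x ^ s) (x ^ d)) d ≡.refl ⟩
        (1# + 0# * X) * T d 0 d + h (suc d) * x ^ (suc d ℕ.* d) * (1# + X)
          ≈⟨ +-cong (*-congˡ (T≈partial d)) (*-congʳ (*-cong (h≈ (suc d)) (^-assocʳ y 2 (suc d ℕ.* d)))) ⟩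
        (1# + 0# * X) * euler-partial y d + -1^ suc d * A * B * (1# + X)
          ≈⟨ solve 5 (λ X θ s A B → (con 𝟙 :+ con 𝟘 :* X) :* θ :+ s :* A :* B :* (con 𝟙 :+ X)
               := θ :+ (s :* (A :* B) :+ s :* (A :* B :* X)))
               refl X (euler-partial y d) (-1^ suc d) A B ⟩
        euler-partial y d + (-1^ suc d * (A * B) + -1^ suc d * (A * B * X))
          ≈⟨ +-congˡ (+-cong (*-congˡ AB≈) (*-congˡ ABX≈)) ⟩
        euler-partial y (suc d) ∎
        where
        X A B : Carrier
        X = x ^ suc d
        A = y ^ (suc d ℕ.* suc (suc d))
        B = y ^ (2 ℕ.* (suc d ℕ.* d))
        eq⁺ : ∀ d → suc d ℕ.* suc (suc d) ℕ.+ 2 ℕ.* (suc d ℕ.* d) ≡ suc d ℕ.* (suc d ℕ.+ (d ℕ.+ suc d))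
        eq⁺ = ℕ-solve
        eq⁻ : ∀ d → suc d ℕ.* (suc d ℕ.+ (d ℕ.+ suc d)) ℕ.+ 2 ℕ.* suc d ≡
          suc d ℕ.* (suc d ℕ.+ (suc d ℕ.+ suc (suc d)))
        eq⁻ = ℕ-solve
        AB≈ : A * B ≈ y ^ pent (+ suc d)
        AB≈ = trans (sym (^-homo-* y (suc d ℕ.* suc (suc d)) _)) (^-≡ y (eq⁺ d))
        ABX≈ : A * B * X ≈ y ^ pent -[1+ d ]
        ABX≈ = trans (*-cong AB≈ (^-assocʳ y 2 (suc d)))
          (trans (sym (^-homo-* y (pent (+ suc d)) (2 ℕ.* suc d))) (^-≡ y (eq⁻ d)))

    euler : ∀ M → x ^ suc M ≈ 0# → euler-partial y M ≈ Poch x M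
    euler M nil = trans (sym (T≈partial M)) (T≈Poch M nil)
      where
      T≈Poch : ∀ M → x ^ suc M ≈ 0# → T M 0 M ≈ Poch x M
      T≈Poch zero    nil = *-identityˡ 1#
      T≈Poch (suc M) nil = trans (+-cong
        (solve 1 (λ p → con 𝟙 :* p :* con 𝟙 := p) refl (Poch x (suc M)))
        (T-tail≈0 small M)) (+-identityʳ _)
        where
        -- The exponent is one short of the nilpotency order for each unit of r; the missing power
        -- of `x` is supplied by the last factor of `h`.
        small : ∀ r → 1 ℕ.≤ r → h r * x ^ (r ℕ.* suc M) ≈ 0#
        small (suc r) (s≤s z≤n) = begin
          - (h r * x ^ suc r) * x ^ (suc r ℕ.* suc M)
            ≈⟨ solve 3 (λ a b c → :- (a :* b) :* c := :- a :* (b :* c)) refl _ _ _ ⟩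
          - h r * (x ^ suc r * x ^ (suc r ℕ.* suc M))
            ≈⟨ *-congˡ (trans (sym (^-homo-* x (suc r) (suc r ℕ.* suc M)))
                 (^-≡ x (≡.sym (ℕₚ.*-suc (suc r) (suc M))))) ⟩
          - h r * x ^ (suc r ℕ.* suc (suc M))
            ≈⟨ trans (*-congˡ (nil-≤ (ℕₚ.m≤n*m (suc (suc M)) (suc r)) nil)) (zeroʳ _) ⟩
          0# ∎

  -- The factors of the generating function

  neg-1* : ∀ x → - 1# * x ≈ - x
  neg-1* = solve 1 (λ x → :- con 𝟙 :* x := :- x) refl

  double-+ : ∀ x → (1# + 1#) * x ≈ x + x
  double-+ = solve 1 (λ x → (con 𝟙 :+ con 𝟙) :* x := x :+ x) refl

  inverse⁺ : ∀ {x g} → g ≈ 1# + x * g → (1# - x) * g ≈ 1#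
  inverse⁺ {x} {g} h = begin
    (1# - x) * g       ≈⟨ solve 2 (λ x g → (con 𝟙 :- x) :* g := g :- x :* g) refl x g ⟩
    g - x * g          ≈⟨ +-congʳ h ⟩
    1# + x * g - x * g ≈⟨ solve 1 (λ x → con 𝟙 :+ x :- x := con 𝟙) refl (x * g) ⟩
    1#                 ∎

  inverse⁻ : ∀ {x g} → g ≈ 1# - x * g → (1# + x) * g ≈ 1#
  inverse⁻ {x} {g} h = begin
    (1# + x) * g       ≈⟨ solve 2 (λ x g → (con 𝟙 :+ x) :* g := g :+ x :* g) refl x g ⟩
    g + x * g          ≈⟨ +-congʳ h ⟩
    1# - x * g + x * g ≈⟨ solve 1 (λ x → con 𝟙 :- x :+ x := con 𝟙) refl (x * g) ⟩
    1#                 ∎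

  -- In characteristic 3, 1 - x⁹ = (1 - x)⁹ and 1 + x⁹ = (1 + x)⁹, so each factor of the product is
  -- ((1 - x) / (1 + x))^(9-1). Here `g` and `h` are the geometric series.
  factor-8 : ∀ {x a b g h} → a ≈ 1# + x → b ≈ 1# - x ^ 9 →
    (1# + x ^ 9) * g ≈ 1# → (1# - x) * h ≈ 1# → a * b * g * h * (1# + x) ^ 8 ≈ (1# - x) ^ 8
  factor-8 {x} {a} {b} {g} {h} a≈ b≈ g≈ h≈ = begin
    a * b * g * h * (1# + x) ^ 8
      ≈⟨ *-congʳ (*-congʳ (*-congʳ (*-cong a≈ b≈))) ⟩
    (1# + x) * (1# - x ^ 9) * g * h * (1# + x) ^ 8
      ≈⟨ solve 3 (λ x g h → (con 𝟙 :+ x) :* (con 𝟙 :- x :^ 9) :* g :* h :* (con 𝟙 :+ x) :^ 8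
           := (con 𝟙 :- x) :^ 8 :* (((con 𝟙 :+ x :^ 9) :* g) :* ((con 𝟙 :- x) :* h))) refl x g h ⟩
    (1# - x) ^ 8 * (((1# + x ^ 9) * g) * ((1# - x) * h))
      ≈⟨ *-congˡ (*-cong g≈ h≈) ⟩
    (1# - x) ^ 8 * (1# * 1#)
      ≈⟨ trans (*-congˡ (*-identityˡ 1#)) (*-identityʳ _) ⟩
    (1# - x) ^ 8 ∎

  ∏-PochOdd-8 : ∀ {x} (f : ℕ → Carrier) →
    (∀ j → let y = x ^ (j ℕ.+ suc (j ℕ.+ 0)) in f j * (1# + y) ^ 8 ≈ (1# - y) ^ 8) →
    ∀ N → ∏ f N * PochOdd (- x) N ^ 8 ≈ PochOdd x N ^ 8
  ∏-PochOdd-8 {x} f h N = begin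
    ∏ f N * PochOdd (- x) N ^ 8     ≈⟨ *-congˡ (∏-^ _ 8 N) ⟨
    ∏ f N * ∏ (λ j → (1# - (- x) ^ (j ℕ.+ suc (j ℕ.+ 0))) ^ 8) N
                                    ≈⟨ ∏-* f _ N ⟨
    ∏ (λ j → f j * (1# - (- x) ^ (j ℕ.+ suc (j ℕ.+ 0))) ^ 8) N
                                    ≈⟨ ∏-cong (λ j → trans (*-congˡ (^-congˡ 8 (neg j))) (h j)) N ⟩
    ∏ (λ j → (1# - x ^ (j ℕ.+ suc (j ℕ.+ 0))) ^ 8) N
                                    ≈⟨ ∏-^ _ 8 N ⟩
    PochOdd x N ^ 8                 ∎
    where
    neg : ∀ j → 1# - (- x) ^ (j ℕ.+ suc (j ℕ.+ 0)) ≈ 1# + x ^ (j ℕ.+ suc (j ℕ.+ 0))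
    neg j = trans (+-congˡ (-‿cong (odd-neg x j))) (solve 1 (λ y → con 𝟙 :- :- y := con 𝟙 :+ y) refl _)

  monomial : ∀ x s r m n → x * (s * (x ^ 3) ^ m * (r * (x ^ 9) ^ n)) ≈
    s * (r * x ^ (1 ℕ.+ (3 ℕ.* m ℕ.+ 9 ℕ.* n)))
  monomial x s r m n = trans
    (solve 5 (λ x s a r b → x :* (s :* a :* (r :* b)) := s :* (r :* (x :* (a :* b))))
      refl x s ((x ^ 3) ^ m) r ((x ^ 9) ^ n))
    (*-congˡ (*-congˡ (*-congˡ (trans (*-cong (^-assocʳ x 3 m) (^-assocʳ x 9 n))
      (sym (^-homo-* x (3 ℕ.* m) (9 ℕ.* n)))))))

  -- Theta functions

  module Theta (M : ℕ) where

    Nil : Carrier → Set ℓ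
    Nil x = x ^ suc M ≈ 0#

    nil^ : ∀ {x} k → Nil x → Nil (x ^ suc k)
    nil^ k = nil-^ {m = suc M} k

    -- φ(-x) and Ω(-x) in Ramanujan's notation
    θ ω : Carrier → Carrier
    θ x = ∑ M λ k → sgn k * x ^ sq k
    ω x = ∑ M λ k → sgn k * x ^ oct k

    term-supported : ∀ {x} {e : ℤ → ℕ} → (∀ k → ∣ k ∣ ℕ.≤ e k) → Nil x →
      ∀ k → M ℕ.< ∣ k ∣ → x ^ e k ≈ 0#
    term-supported e≥ nil k lt = nil-≤ (ℕₚ.≤-trans lt (e≥ k)) nil

    θ-cong : ∀ {x y} → x ≈ y → θ x ≈ θ y
    θ-cong e = ∑-cong M λ k → *-congˡ (^-congˡ (sq k) e)

    ω-cong : ∀ {x y} → x ≈ y → ω x ≈ ω y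
    ω-cong e = ∑-cong M λ k → *-congˡ (^-congˡ (oct k) e)

    -- Gauss's theorem has `PochPlus` as denominator; Euler's partition identity turns its inverse
    -- into `PochOdd`.
    θ-product : ∀ {x} → Nil x → θ x ≈ Poch (x ^ 2) M * PochOdd x M ^ 2
    θ-product {x} nil = begin
      θ x                                        ≈⟨ *-identityˡ _ ⟨
      1# * θ x                                   ≈⟨ *-congʳ PochOdd*PochPlus ⟨
      PochOdd x M * PochPlus x M * θ x           ≈⟨ *-assoc _ _ _ ⟩
      PochOdd x M * (PochPlus x M * θ x)         ≈⟨ *-congˡ (gauss x M nil) ⟩
      PochOdd x M * Poch x M                     ≈⟨ *-congˡ Poch≈PochOdd*Poch² ⟩
      PochOdd x M * (PochOdd x M * Poch (x ^ 2) M)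
        ≈⟨ solve 2 (λ a b → a :* (a :* b) := b :* a :^ 2) refl _ _ ⟩
      Poch (x ^ 2) M * PochOdd x M ^ 2           ∎
      where open Nilpotent M nil

    -- Cubing is additive and every sign is its own cube.
    θ-cube : ∀ x → θ x ^ 3 ≈ θ (x ^ 3)
    θ-cube x = trans (sym (∑-cube _ M)) (∑-cong M λ k → begin
      (sgn k * x ^ sq k) ^ 3                    ≈⟨ solve 2 (λ s y → (s :* y) :^ 3 := s :* s :* (s :* y :^ 3)) refl (sgn k) _ ⟩
      sgn k * sgn k * (sgn k * (x ^ sq k) ^ 3)  ≈⟨ trans (*-congʳ (sgn² k)) (*-identityˡ _) ⟩
      sgn k * (x ^ sq k) ^ 3                    ≈⟨ *-congˡ (^-swap x (sq k) 3) ⟩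
      sgn k * (x ^ 3) ^ sq k                    ∎)

    -- Split the summation index mod 3. The classes 1 and -1 are mirror images with equal sums, and
    -- their joint coefficient -2 is 1.
    θ-dissection : ∀ {x} → Nil x → θ x ≈ θ (x ^ 9) + x * ω (x ^ 3)
    θ-dissection {x} nil = begin
      θ x
        ≈⟨ ∑-≥ (λ k lt → trans (*-congˡ (term-supported sq-≥ nil k lt)) (zeroʳ _)) M≤ ⟨
      ∑ (suc (triple M)) h
        ≈⟨ ∑-thirds h M ⟩
      ∑ M (λ k → h (+ 3 ℤ.* k)) +
        (∑ M (λ k → h (+ 3 ℤ.* k ℤ.+ + 1)) + ∑ M (λ k → h (+ 3 ℤ.* k ℤ.- + 1)))
        ≈⟨ +-cong (∑-cong M multiples) (+-cong up down) ⟩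
      θ (x ^ 9) + (- x * ω (x ^ 3) + - x * ω (x ^ 3))
        ≈⟨ solve 3 (λ a b c → a :+ (:- b :* c :+ :- b :* c) := a :+ b :* c) refl _ _ _ ⟩
      θ (x ^ 9) + x * ω (x ^ 3) ∎
      where
      h : ℤ → Carrier
      h k = sgn k * x ^ sq k
      h-neg : ∀ k → h (ℤ.- k) ≈ h k
      h-neg k = *-cong (sgn-neg k) (^-≡ x (≡.cong₂ ℕ._*_ (ℤₚ.∣-i∣≡∣i∣ k) (ℤₚ.∣-i∣≡∣i∣ k)))
      M≤ : M ℕ.≤ suc (triple M)
      M≤ = ℕₚ.m≤n⇒m≤1+n (≡.subst (M ℕ.≤_) (≡.sym (triple≡ M)) (ℕₚ.m≤m+n M _))
      multiples : ∀ k → h (+ 3 ℤ.* k) ≈ sgn k * (x ^ 9) ^ sq k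
      multiples k = *-cong (sgn-3* k) (trans (^-≡ x (sq-3k k)) (sym (^-assocʳ x 9 (sq k))))
      below : ∀ k → h (+ 3 ℤ.* k ℤ.- + 1) ≈ - x * (sgn k * (x ^ 3) ^ oct k)
      below k = begin
        sgn (+ 3 ℤ.* k ℤ.- + 1) * x ^ sq (+ 3 ℤ.* k ℤ.- + 1)
          ≈⟨ *-cong (trans (sgn-sub (+ 3 ℤ.* k) (+ 1)) (*-congʳ (sgn-3* k))) (^-≡ x (sq-3k-1 k)) ⟩
        sgn k * (- 1# * 1#) * (x * x ^ (3 ℕ.* oct k))
          ≈⟨ *-congˡ (*-congˡ (sym (^-assocʳ x 3 (oct k)))) ⟩
        sgn k * (- 1# * 1#) * (x * (x ^ 3) ^ oct k)
          ≈⟨ solve 3 (λ s x y → s :* (:- con 𝟙 :* con 𝟙) :* (x :* y) := :- x :* (s :* y)) refl _ x _ ⟩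
        - x * (sgn k * (x ^ 3) ^ oct k) ∎
      down : ∑ M (λ k → h (+ 3 ℤ.* k ℤ.- + 1)) ≈ - x * ω (x ^ 3)
      down = trans (∑-cong M below) (∑-*ˡ _ _ M)
      flip : ∀ k → + 3 ℤ.* (ℤ.- k) ℤ.+ + 1 ≡ ℤ.- (+ 3 ℤ.* k ℤ.- + 1)
      flip = ℤ-solve
      up : ∑ M (λ k → h (+ 3 ℤ.* k ℤ.+ + 1)) ≈ - x * ω (x ^ 3)
      up = trans (sym (∑-neg _ M)) (trans (∑-cong M λ k →
        trans (reflexive (≡.cong h (flip k))) (h-neg (+ 3 ℤ.* k ℤ.- + 1))) down)

    neg-sq : ∀ x k → (- x) ^ sq k ≈ sgn k * x ^ sq k
    neg-sq x k = trans (neg-^ x (sq k)) (*-congʳ (-1^-sq k))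

    neg-oct : ∀ x k → (- x) ^ oct k ≈ sgn k * x ^ oct k
    neg-oct x k = trans (neg-^ x (oct k)) (*-congʳ (-1^-oct k))

    ∑*∑ : ∀ f g → ∑ M f * ∑ M g ≈ ∑ M (λ i → ∑ M (λ j → f i * g j))
    ∑*∑ f g = sym (trans (∑-cong M λ i → ∑-*ˡ (f i) g M) (∑-*ʳ f (∑ M g) M))

    -- The signs on the left cancel unless x ≡ y mod 2, and there the exponent
    -- 3x² + y (3y - 2) splits as a sum in the coordinates x = u - v, y = u + v.
    θω-euler : ∀ {t} → Nil t →
      θ (t ^ 3) * ω (- t) + θ ((- t) ^ 3) * ω t ≈ (1# + 1#) * Poch ((t ^ 2) ^ 2) M ^ 2
    θω-euler {t} nil = begin
      θ (t ^ 3) * ω (- t) + θ ((- t) ^ 3) * ω t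
        ≈⟨ +-cong (∑*∑ _ _) (∑*∑ _ _) ⟩
      ∑ M (λ x → ∑ M (λ y → sgn x * (t ^ 3) ^ sq x * (sgn y * (- t) ^ oct y))) +
        ∑ M (λ x → ∑ M (λ y → sgn x * ((- t) ^ 3) ^ sq x * (sgn y * t ^ oct y)))
        ≈⟨ trans (∑-cong M λ x → ∑-+ _ _ M) (∑-+ _ _ M) ⟨
      ∑ M (λ x → ∑ M (λ y → sgn x * (t ^ 3) ^ sq x * (sgn y * (- t) ^ oct y) +
        sgn x * ((- t) ^ 3) ^ sq x * (sgn y * t ^ oct y)))
        ≈⟨ ∑-cong M (λ x → ∑-cong M λ y → merge x y) ⟩
      ∑ M (λ x → ∑ M (K x))
        ≈⟨ ∑∑-lattice K F K-x K-y K-odd F-u F-v K≈F ⟩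
      ∑ M (λ u → ∑ M (F u))
        ≈⟨ trans (∑-cong M λ u → ∑-*ˡ (1# + 1#) _ M) (∑-*ˡ (1# + 1#) _ M) ⟩
      (1# + 1#) * ∑ M (λ u → ∑ M (λ v → f u * f v))
        ≈⟨ *-congˡ (∑*∑ f f) ⟨
      (1# + 1#) * (∑ M f * ∑ M f)
        ≈⟨ *-congˡ (*-cong (euler (t ^ 2) M nil⁴) (euler (t ^ 2) M nil⁴)) ⟩
      (1# + 1#) * (Poch ((t ^ 2) ^ 2) M * Poch ((t ^ 2) ^ 2) M)
        ≈⟨ *-congˡ (*-congˡ (sym (*-identityʳ _))) ⟩
      (1# + 1#) * Poch ((t ^ 2) ^ 2) M ^ 2 ∎
      where
      nil⁴ : Nil ((t ^ 2) ^ 2)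
      nil⁴ = nil^ 1 (nil^ 1 nil)
      f : ℤ → Carrier
      f u = sgn u * (t ^ 2) ^ pent u
      K F : ℤ → ℤ → Carrier
      -- Replacing t by -t contributes `sgn y` in the first product and `sgn x` in the second. Each
      -- cancels a sign already present, so a single sign survives in either product.
      K x y = (sgn x + sgn y) * ((t ^ 3) ^ sq x * t ^ oct y)
      F u v = (1# + 1#) * (f u * f v)
      neg-cube : (- t) ^ 3 ≈ - (t ^ 3)
      neg-cube = solve 1 (λ t → (:- t) :^ 3 := :- (t :^ 3)) refl t
      merge : ∀ x y → sgn x * (t ^ 3) ^ sq x * (sgn y * (- t) ^ oct y) +
        sgn x * ((- t) ^ 3) ^ sq x * (sgn y * t ^ oct y) ≈ K x y
      merge x y = begin
        sgn x * A * (sgn y * (- t) ^ oct y) + sgn x * ((- t) ^ 3) ^ sq x * (sgn y * B)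
          ≈⟨ +-cong (*-congˡ (*-congˡ (neg-oct t y)))
               (*-congʳ (*-congˡ (trans (^-congˡ (sq x) neg-cube) (neg-sq (t ^ 3) x)))) ⟩
        sgn x * A * (sgn y * (sgn y * B)) + sgn x * (sgn x * A) * (sgn y * B)
          ≈⟨ solve 4 (λ s r A B → s :* A :* (r :* (r :* B)) :+ s :* (s :* A) :* (r :* B)
               := (r :* r :* s :+ s :* s :* r) :* (A :* B)) refl _ _ _ _ ⟩
        (sgn y * sgn y * sgn x + sgn x * sgn x * sgn y) * (A * B)
          ≈⟨ *-congʳ (+-cong (trans (*-congʳ (sgn² y)) (*-identityˡ _))
               (trans (*-congʳ (sgn² x)) (*-identityˡ _))) ⟩
        K x y ∎
        where
        A B : Carrier
        A = (t ^ 3) ^ sq x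
        B = t ^ oct y
      K-x : ∀ x y → M ℕ.< ∣ x ∣ → K x y ≈ 0#
      K-x x y lt = trans (*-congˡ (trans (*-congʳ (term-supported sq-≥ (nil^ 2 nil) x lt)) (zeroˡ _))) (zeroʳ _)
      K-y : ∀ x y → M ℕ.< ∣ y ∣ → K x y ≈ 0#
      K-y x y lt = trans (*-congˡ (trans (*-congˡ (term-supported oct-≥ nil y lt)) (zeroʳ _))) (zeroʳ _)
      K-odd : ∀ x k → K x (x ℤ.+ (+ 1 ℤ.+ (k ℤ.+ k))) ≈ 0#
      K-odd x k = trans (*-congʳ (begin
        sgn x + sgn (x ℤ.+ (+ 1 ℤ.+ (k ℤ.+ k)))
          ≈⟨ +-congˡ (trans (sgn-+ x _) (*-congˡ (trans (sgn-+ (+ 1) (k ℤ.+ k)) (*-congˡ (trans (sgn-+ k k) (sgn² k)))))) ⟩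
        sgn x + sgn x * (- 1# * 1# * 1#)
          ≈⟨ solve 1 (λ s → s :+ s :* (:- con 𝟙 :* con 𝟙 :* con 𝟙) := con 𝟘) refl (sgn x) ⟩
        0# ∎)) (zeroˡ _)
      f-supported : ∀ u → M ℕ.< ∣ u ∣ → f u ≈ 0#
      f-supported u lt = trans (*-congˡ (term-supported pent-≥ (nil^ 1 nil) u lt)) (zeroʳ _)
      F-u : ∀ u v → M ℕ.< ∣ u ∣ → F u v ≈ 0#
      F-u u v lt = trans (*-congˡ (trans (*-congʳ (f-supported u lt)) (zeroˡ _))) (zeroʳ _)
      F-v : ∀ u v → M ℕ.< ∣ v ∣ → F u v ≈ 0#
      F-v u v lt = trans (*-congˡ (trans (*-congˡ (f-supported v lt)) (zeroʳ _))) (zeroʳ _)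
      K≈F : ∀ u v → K (u ℤ.- v) (u ℤ.+ v) ≈ F u v
      K≈F u v = begin
        (sgn (u ℤ.- v) + sgn (u ℤ.+ v)) * ((t ^ 3) ^ sq (u ℤ.- v) * t ^ oct (u ℤ.+ v))
          ≈⟨ *-cong (+-cong (sgn-sub u v) (sgn-+ u v)) powers ⟩
        (sgn u * sgn v + sgn u * sgn v) * ((t ^ 2) ^ pent u * (t ^ 2) ^ pent v)
          ≈⟨ solve 4 (λ s r A B → (s :* r :+ s :* r) :* (A :* B)
               := (con 𝟙 :+ con 𝟙) :* (s :* A :* (r :* B))) refl _ _ _ _ ⟩
        F u v ∎
        where
        powers : (t ^ 3) ^ sq (u ℤ.- v) * t ^ oct (u ℤ.+ v) ≈ (t ^ 2) ^ pent u * (t ^ 2) ^ pent v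
        powers = begin
          (t ^ 3) ^ sq (u ℤ.- v) * t ^ oct (u ℤ.+ v)
            ≈⟨ *-congʳ (^-assocʳ t 3 (sq (u ℤ.- v))) ⟩
          t ^ (3 ℕ.* sq (u ℤ.- v)) * t ^ oct (u ℤ.+ v)
            ≈⟨ trans (sym (^-homo-* t (3 ℕ.* sq (u ℤ.- v)) _)) (^-≡ t (sq-oct-rotate u v)) ⟩
          t ^ (2 ℕ.* pent u ℕ.+ 2 ℕ.* pent v)
            ≈⟨ ^-homo-* t (2 ℕ.* pent u) (2 ℕ.* pent v) ⟩
          t ^ (2 ℕ.* pent u) * t ^ (2 ℕ.* pent v)
            ≈⟨ *-cong (^-assocʳ t 2 (pent u)) (^-assocʳ t 2 (pent v)) ⟨
          (t ^ 2) ^ pent u * (t ^ 2) ^ pent v ∎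

    -- Dissection of the generating function over a subring

    θ-0 : ∀ {x} → x ≈ 0# → θ x ≈ 1#
    θ-0 {x} x≈0 = trans (∑-≥ {L = M} supp z≤n) (*-identityˡ 1#)
      where
      supp : Supported 0 (λ k → sgn k * x ^ sq k)
      supp k lt = trans (*-congˡ (nil-≤ {m = 1} (ℕₚ.≤-trans lt (sq-≥ k))
        (trans (*-identityʳ x) x≈0))) (zeroʳ _)

    -- An abstract stand-in for F₃[q³]: the dissection can then be carried out as plain algebra,
    -- without mentioning coefficients.
    record IsSubring {p} (P : Carrier → Set p) : Set (c ⊔ ℓ ⊔ p) where
      field
        resp       : ∀ {x y} → x ≈ y → P x → P y
        1-closed   : P 1#
        neg-closed : ∀ {x} → P x → P (- x)
        +-closed   : ∀ {x y} → P x → P y → P (x + y)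
        *-closed   : ∀ {x y} → P x → P y → P (x * y)

      ^-closed : ∀ {x} n → P x → P (x ^ n)
      ^-closed zero    px = 1-closed
      ^-closed (suc n) px = *-closed px (^-closed n px)

      ∑-closed : ∀ {g} L → (∀ k → P (g k)) → P (∑ L g)
      ∑-closed zero    h = h (+ 0)
      ∑-closed (suc L) h = +-closed (∑-closed L h) (+-closed (h (+ suc L)) (h -[1+ L ]))

      sgn-closed : ∀ k → P (sgn k)
      sgn-closed k = ^-closed ∣ k ∣ (neg-closed 1-closed)

      θ-closed : ∀ {x} → P x → P (θ x)
      θ-closed px = ∑-closed M λ k → *-closed (sgn-closed k) (^-closed (sq k) px)

      ω-closed : ∀ {x} → P x → P (ω x)
      ω-closed px = ∑-closed M λ k → *-closed (sgn-closed k) (^-closed (oct k) px)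

      -- As θ(x)³ = θ(x³), an inverse of θ(x) is θ(x)² times an inverse of θ(x³), and after n
      -- cubings the argument is zero. Closure of `P` under inverses is not among the subring laws;
      -- this construction uses only products of theta values.
      θ-unit : ∀ n {x} → P x → x ^ (3 ℕ.^ n) ≈ 0# → Σ (Unit (θ x)) λ u → P (proj₁ u)
      θ-unit zero {x} px h =
        (1# , trans (*-identityʳ _) (θ-0 (trans (sym (*-identityʳ x)) h))) , 1-closed
      θ-unit (suc n) {x} px h with θ-unit n {x ^ 3} (^-closed 3 px) (trans (^-assocʳ x 3 (3 ℕ.^ n)) h)
      ... | (v , e) , pv = (θ x ^ 2 * v , (begin
        θ x * (θ x ^ 2 * v)  ≈⟨ sym (*-assoc _ _ _) ⟩
        θ x ^ 3 * v          ≈⟨ *-congʳ (θ-cube x) ⟩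
        θ (x ^ 3) * v        ≈⟨ e ⟩
        1#                   ∎)) , *-closed (^-closed 2 (θ-closed px)) pv

    module _ {p} {P : Carrier → Set p} (isSubring : IsSubring P) where
      open IsSubring isSubring

      -- Here α = φ(q), β = φ(-q), a = φ(q⁹) and G = α²βC / a. Expanding (a - qw)²(a′ + qw′) with -2
      -- = 1, the coefficient of q is a(a′w + aw′), so the a in front cancels the denominator. The
      -- q³ term is t times an element of `P` and goes into `S₀`.
      generating-function : ∀ {q G} → Nil q → P (q ^ 3) →
        G * PochOdd (- q) M ^ 8 ≈ PochOdd q M ^ 8 →
        Σ Carrier λ S₀ → Σ Carrier λ S₂ → P S₀ × P S₂ ×
          G ≈ (1# + 1#) * (q * (∑ M (λ u → sgn u * (q ^ 3) ^ pent u) * ∑ M (λ v → sgn v * (q ^ 9) ^ pent v)))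
            + (S₀ + q ^ 2 * S₂)
      generating-function {q} {G} nil pt hG =
        (a ^ 2 * a′ + t * (w ^ 2 * w′)) * (C * b) ,
        (a′ * w ^ 2 + a * w * w′) * (C * b) ,
        *-closed (+-closed (*-closed (^-closed 2 pa) pa′) (*-closed pt (*-closed (^-closed 2 pw) pw′))) pCb ,
        *-closed (+-closed (*-closed pa′ (^-closed 2 pw)) (*-closed (*-closed pa pw) pw′)) pCb ,
        (begin
          G
            ≈⟨ *-identityʳ G ⟨
          G * 1#
            ≈⟨ *-congˡ ab≈1 ⟨
          G * (a * b)
            ≈⟨ trans (sym (*-assoc _ _ _)) (*-congʳ Ga≈) ⟩
          α ^ 2 * β * C * b
            ≈⟨ *-congʳ (*-congʳ (*-cong (^-congˡ 2 α≈) β≈)) ⟩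
          (a + - q * w) ^ 2 * (a′ + q * w′) * C * b
            ≈⟨ solve 7 (λ a a′ w w′ q C b → (a :+ :- q :* w) :^ 2 :* (a′ :+ q :* w′) :* C :* b
                 := q :* ((a′ :* w :+ a :* w′) :* C) :* (a :* b) :+
                   ((a :^ 2 :* a′ :+ q :^ 3 :* (w :^ 2 :* w′)) :* (C :* b) :+
                    q :^ 2 :* ((a′ :* w :^ 2 :+ a :* w :* w′) :* (C :* b)))) refl a a′ w w′ q C b ⟩
          q * ((a′ * w + a * w′) * C) * (a * b) + E
            ≈⟨ +-congʳ (trans (*-congˡ ab≈1) (*-identityʳ _)) ⟩
          q * ((a′ * w + a * w′) * C) + E
            ≈⟨ +-congʳ (*-congˡ main) ⟩
          q * ((1# + 1#) * (U * V)) + E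
            ≈⟨ +-congʳ (solve 3 (λ q x y → q :* ((con 𝟙 :+ con 𝟙) :* (x :* y))
                 := (con 𝟙 :+ con 𝟙) :* (q :* (x :* y))) refl q U V) ⟩
          (1# + 1#) * (q * (U * V)) + E ∎)
        where
        t α β a a′ w w′ C U V : Carrier
        t = q ^ 3
        α = θ (- q)
        β = θ q
        a = θ ((- t) ^ 3)
        a′ = θ (t ^ 3)
        w = ω (- t)
        w′ = ω t
        C = θ (- t) * θ t
        U = ∑ M (λ u → sgn u * t ^ pent u)
        V = ∑ M (λ v → sgn v * (q ^ 9) ^ pent v)
        nil-t : Nil t
        nil-t = nil^ 2 nil
        nil--t : Nil (- t)
        nil--t = nil-neg {m = suc M} nil-t
        unit-a : Σ (Unit a) λ u → P (proj₁ u)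
        unit-a = θ-unit M (^-closed 3 (neg-closed pt)) (nil-≤ (n<3^n M) (nil^ 2 nil--t))
        b : Carrier
        b = proj₁ (proj₁ unit-a)
        ab≈1 : a * b ≈ 1#
        ab≈1 = proj₂ (proj₁ unit-a)
        E : Carrier
        E = (a ^ 2 * a′ + t * (w ^ 2 * w′)) * (C * b) + q ^ 2 * ((a′ * w ^ 2 + a * w * w′) * (C * b))
        pa : P a
        pa = θ-closed (^-closed 3 (neg-closed pt))
        pa′ : P a′
        pa′ = θ-closed (^-closed 3 pt)
        pw : P w
        pw = ω-closed (neg-closed pt)
        pw′ : P w′
        pw′ = ω-closed pt
        pCb : P (C * b)
        pCb = *-closed (*-closed (θ-closed (neg-closed pt)) (θ-closed pt)) (proj₂ unit-a)
        neg-cube : (- q) ^ 3 ≈ - t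
        neg-cube = solve 1 (λ q → (:- q) :^ 3 := :- (q :^ 3)) refl q
        q⁹ : ∀ x → x ^ 9 ≈ (x ^ 3) ^ 3
        q⁹ x = sym (^-assocʳ x 3 3)
        α≈ : α ≈ a + - q * w
        α≈ = trans (θ-dissection (nil-neg {m = suc M} nil))
          (+-cong (θ-cong (trans (q⁹ (- q)) (^-congˡ 3 neg-cube))) (*-congˡ (ω-cong neg-cube)))
        β≈ : β ≈ a′ + q * w′
        β≈ = trans (θ-dissection nil) (+-congʳ (θ-cong (q⁹ q)))
        α³ : α ^ 3 ≈ θ (- t)
        α³ = trans (θ-cube (- q)) (θ-cong neg-cube)
        q² : (- q) ^ 2 ≈ q ^ 2
        q² = solve 1 (λ q → (:- q) :^ 2 := q :^ 2) refl q
        Gα⁴ : G * α ^ 4 ≈ β ^ 4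
        Gα⁴ = begin
          G * α ^ 4
            ≈⟨ *-congˡ (^-congˡ 4 (trans (θ-product (nil-neg {m = suc M} nil)) (*-congʳ (Poch-cong M q²)))) ⟩
          G * (Poch (q ^ 2) M * PochOdd (- q) M ^ 2) ^ 4
            ≈⟨ solve 3 (λ G f o → G :* (f :* o :^ 2) :^ 4 := f :^ 4 :* (G :* o :^ 8)) refl G _ _ ⟩
          Poch (q ^ 2) M ^ 4 * (G * PochOdd (- q) M ^ 8)
            ≈⟨ *-congˡ hG ⟩
          Poch (q ^ 2) M ^ 4 * PochOdd q M ^ 8
            ≈⟨ solve 2 (λ f o → f :^ 4 :* o :^ 8 := (f :* o :^ 2) :^ 4) refl _ _ ⟩
          (Poch (q ^ 2) M * PochOdd q M ^ 2) ^ 4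
            ≈⟨ ^-congˡ 4 (θ-product nil) ⟨
          β ^ 4 ∎
        -- Two cubings give a = α⁹. Of the nine factors four convert G into β⁴, and α⁵β⁴ = α²β(αβ)³
        -- leaves cubes that become theta values in t.
        Ga≈ : G * a ≈ α ^ 2 * β * C
        Ga≈ = begin
          G * a
            ≈⟨ *-congˡ (trans (^-congˡ 3 α³) (θ-cube (- t))) ⟨
          G * (α ^ 3) ^ 3
            ≈⟨ solve 2 (λ G α → G :* (α :^ 3) :^ 3 := α :^ 5 :* (G :* α :^ 4)) refl G α ⟩
          α ^ 5 * (G * α ^ 4)
            ≈⟨ *-congˡ Gα⁴ ⟩
          α ^ 5 * β ^ 4
            ≈⟨ solve 2 (λ α β → α :^ 5 :* β :^ 4 := α :^ 2 :* β :* (α :^ 3 :* β :^ 3)) refl α β ⟩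
          α ^ 2 * β * (α ^ 3 * β ^ 3)
            ≈⟨ *-congˡ (*-cong α³ (θ-cube q)) ⟩
          α ^ 2 * β * C ∎
        t² : (- t) ^ 2 ≈ t ^ 2
        t² = solve 1 (λ q → (:- q) :^ 2 := q :^ 2) refl t
        f₆ f₁₂ : Carrier
        f₆ = Poch (t ^ 2) M
        f₁₂ = Poch ((t ^ 2) ^ 2) M
        -- The product of `PochOdd t M` and `PochOdd (- t) M` is `PochOdd (t ^ 2) M`, exactly what
        -- completes `f₁₂` to `f₆`. Of the resulting f₆⁴ three factors are then cubed into f₁₈, so
        -- that Euler's theorem applies to both remaining products.
        main : (a′ * w + a * w′) * C ≈ (1# + 1#) * (U * V)
        main = begin
          (a′ * w + a * w′) * C
            ≈⟨ *-cong (θω-euler nil-t) (*-cong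
                 (trans (θ-product nil--t) (*-congʳ (Poch-cong M t²))) (θ-product nil-t)) ⟩
          (1# + 1#) * f₁₂ ^ 2 * (f₆ * PochOdd (- t) M ^ 2 * (f₆ * PochOdd t M ^ 2))
            ≈⟨ solve 4 (λ f g m p → (con 𝟙 :+ con 𝟙) :* f :^ 2 :* (g :* m :^ 2 :* (g :* p :^ 2))
                 := (con 𝟙 :+ con 𝟙) :* ((p :* m :* f) :^ 2 :* g :^ 2)) refl f₁₂ f₆ _ _ ⟩
          (1# + 1#) * ((PochOdd t M * PochOdd (- t) M * f₁₂) ^ 2 * f₆ ^ 2)
            ≈⟨ *-congˡ (*-congʳ (^-congˡ 2 (trans (*-congʳ (PochOdd*neg t M))
                 (sym (Nilpotent.Poch≈PochOdd*Poch² M (nil^ 1 nil-t)))))) ⟩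
          (1# + 1#) * (f₆ ^ 2 * f₆ ^ 2)
            ≈⟨ *-congˡ (solve 1 (λ g → g :^ 2 :* g :^ 2 := g :* g :^ 3) refl f₆) ⟩
          (1# + 1#) * (f₆ * f₆ ^ 3)
            ≈⟨ *-congˡ (*-congˡ (trans (Poch-cube (t ^ 2) M) (Poch-cong M (trans (^-swap t 2 3) (^-congˡ 2 (sym (q⁹ q))))))) ⟩
          (1# + 1#) * (f₆ * Poch ((q ^ 9) ^ 2) M)
            ≈⟨ *-congˡ (*-cong (euler t M (nil^ 1 nil-t)) (euler (q ^ 9) M (nil^ 1 (nil^ 8 nil)))) ⟨
          (1# + 1#) * (U * V) ∎

-- Power series modulo 3

infix 4 _≡₃_
_≡₃_ : ℤ → ℤ → Set
a ≡₃ b = + 3 ℤ∣.∣ a ℤ.- b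

∣-≡ : ∀ {a b} → a ≡ b → + 3 ℤ∣.∣ a → + 3 ℤ∣.∣ b
∣-≡ = ≡.subst (+ 3 ℤ∣.∣_)

≡₃-reflexive : ∀ {a b} → a ≡ b → a ≡₃ b
≡₃-reflexive {a} ≡.refl = divides (+ 0) (ℤₚ.+-inverseʳ a)

≡₃-sym : ∀ {a b} → a ≡₃ b → b ≡₃ a
≡₃-sym {a} {b} h = ∣-≡ (eq a b) (ℤ∣.∣m⇒∣-m h)
  where
  eq : ∀ a b → ℤ.- (a ℤ.- b) ≡ b ℤ.- a
  eq = ℤ-solve

≡₃-trans : ∀ {a b c} → a ≡₃ b → b ≡₃ c → a ≡₃ c
≡₃-trans {a} {b} {c} h k = ∣-≡ (eq a b c) (ℤ∣.∣m∣n⇒∣m+n h k)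
  where
  eq : ∀ a b c → (a ℤ.- b) ℤ.+ (b ℤ.- c) ≡ a ℤ.- c
  eq = ℤ-solve

≡₃-+ : ∀ {a b c d} → a ≡₃ b → c ≡₃ d → a ℤ.+ c ≡₃ b ℤ.+ d
≡₃-+ {a} {b} {c} {d} h k = ∣-≡ (eq a b c d) (ℤ∣.∣m∣n⇒∣m+n h k)
  where
  eq : ∀ a b c d → (a ℤ.- b) ℤ.+ (c ℤ.- d) ≡ a ℤ.+ c ℤ.- (b ℤ.+ d)
  eq = ℤ-solve

≡₃-* : ∀ {a b c d} → a ≡₃ b → c ≡₃ d → a ℤ.* c ≡₃ b ℤ.* d
≡₃-* {a} {b} {c} {d} h k = ∣-≡ (eq a b c d) (ℤ∣.∣m∣n⇒∣m+n (ℤ∣.∣n⇒∣m*n c h) (ℤ∣.∣n⇒∣m*n b k))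
  where
  eq : ∀ a b c d → c ℤ.* (a ℤ.- b) ℤ.+ b ℤ.* (c ℤ.- d) ≡ a ℤ.* c ℤ.- b ℤ.* d
  eq = ℤ-solve

≡₃-neg : ∀ {a b} → a ≡₃ b → ℤ.- a ≡₃ ℤ.- b
≡₃-neg {a} {b} h = ∣-≡ (eq a b) (ℤ∣.∣m⇒∣-m h)
  where
  eq : ∀ a b → ℤ.- (a ℤ.- b) ≡ ℤ.- a ℤ.- ℤ.- b
  eq = ℤ-solve

≡₃0⇒∣ : ∀ {a} → a ≡₃ + 0 → + 3 ℤ∣.∣ a
≡₃0⇒∣ {a} = ∣-≡ (ℤₚ.+-identityʳ a)

∣⇒≡₃0 : ∀ {a} → + 3 ℤ∣.∣ a → a ≡₃ + 0
∣⇒≡₃0 {a} = ∣-≡ (≡.sym (ℤₚ.+-identityʳ a))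

·-zero : ∀ f g → (f · g) 0 ≡ f 0 ℤ.* g 0
·-zero f g = ℤₚ.+-identityʳ _

-- Peeling off the constant term of the left factor is the recursion by which the ring laws are
-- proved, by induction on the degree.
·-suc : ∀ f g n → (f · g) (suc n) ≡ f 0 ℤ.* g (suc n) ℤ.+ ((f ∘ suc) · g) n
·-suc f g n = ≡.cong (λ l → f 0 ℤ.* g (suc n) ℤ.+ foldr ℤ._+_ (+ 0) l)
  (≡.trans (map-applyUpTo suc (λ k → f k ℤ.* g (suc n ℕ.∸ k)) (suc n))
    (≡.sym (map-applyUpTo (λ k → k) (λ k → f (suc k) ℤ.* g (n ℕ.∸ k)) (suc n))))

-- The mirror image of `·-suc`; commutativity follows by playing the two against each other.
·-sucʳ : ∀ f g n → (f · g) (suc n) ≡ (f · (g ∘ suc)) n ℤ.+ f (suc n) ℤ.* g 0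
·-sucʳ f g zero    = ≡.trans (·-suc f g 0) (≡.cong₂ ℤ._+_ (≡.sym (·-zero f (g ∘ suc))) (·-zero (f ∘ suc) g))
·-sucʳ f g (suc n) = ≡.trans (·-suc f g (suc n)) (≡.trans
  (≡.cong (λ z → f 0 ℤ.* g (suc (suc n)) ℤ.+ z) (·-sucʳ (f ∘ suc) g n))
  (≡.trans (≡.sym (ℤₚ.+-assoc (f 0 ℤ.* g (suc (suc n))) _ _))
    (≡.cong (ℤ._+ f (suc (suc n)) ℤ.* g 0) (≡.sym (·-suc f (g ∘ suc) n)))))

·-comm : ∀ f g n → (f · g) n ≡ (g · f) n
·-comm f g zero    = ≡.trans (·-zero f g) (≡.trans (ℤₚ.*-comm (f 0) (g 0)) (≡.sym (·-zero g f)))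
·-comm f g (suc n) = ≡.trans (·-suc f g n) (≡.trans
  (≡.cong₂ ℤ._+_ (ℤₚ.*-comm (f 0) (g (suc n))) (·-comm (f ∘ suc) g n))
  (≡.trans (ℤₚ.+-comm (g (suc n) ℤ.* f 0) _) (≡.sym (·-sucʳ g f n))))

·-distribʳ : ∀ f g h n → ((λ k → f k ℤ.+ g k) · h) n ≡ (f · h) n ℤ.+ (g · h) n
·-distribʳ f g h zero = ≡.trans (·-zero (λ k → f k ℤ.+ g k) h) (≡.trans
  (ℤₚ.*-distribʳ-+ (h 0) (f 0) (g 0)) (≡.sym (≡.cong₂ ℤ._+_ (·-zero f h) (·-zero g h))))
·-distribʳ f g h (suc n) = ≡.trans (·-suc (λ k → f k ℤ.+ g k) h n) (≡.trans
  (≡.cong (λ z → (f 0 ℤ.+ g 0) ℤ.* h (suc n) ℤ.+ z) (·-distribʳ (f ∘ suc) (g ∘ suc) h n))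
  (≡.trans (eq (f 0) (g 0) (h (suc n)) _ _) (≡.sym (≡.cong₂ ℤ._+_ (·-suc f h n) (·-suc g h n)))))
  where
  eq : ∀ a b c x y → (a ℤ.+ b) ℤ.* c ℤ.+ (x ℤ.+ y) ≡ a ℤ.* c ℤ.+ x ℤ.+ (b ℤ.* c ℤ.+ y)
  eq = ℤ-solve

·-scale : ∀ c f g n → ((λ k → c ℤ.* f k) · g) n ≡ c ℤ.* (f · g) n
·-scale c f g zero = ≡.trans (·-zero (λ k → c ℤ.* f k) g) (≡.trans
  (ℤₚ.*-assoc c (f 0) (g 0)) (≡.cong (c ℤ.*_) (≡.sym (·-zero f g))))
·-scale c f g (suc n) = ≡.trans (·-suc (λ k → c ℤ.* f k) g n) (≡.trans
  (≡.cong (λ z → c ℤ.* f 0 ℤ.* g (suc n) ℤ.+ z) (·-scale c (f ∘ suc) g n))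
  (≡.trans (eq c (f 0) (g (suc n)) _) (≡.cong (c ℤ.*_) (≡.sym (·-suc f g n)))))
  where
  eq : ∀ c a b x → c ℤ.* a ℤ.* b ℤ.+ c ℤ.* x ≡ c ℤ.* (a ℤ.* b ℤ.+ x)
  eq = ℤ-solve

·-congˡ≡ : ∀ {f f′} g n → (∀ k → f k ≡ f′ k) → (f · g) n ≡ (f′ · g) n
·-congˡ≡ {f} {f′} g zero h = ≡.trans (·-zero f g) (≡.trans (≡.cong (ℤ._* g 0) (h 0)) (≡.sym (·-zero f′ g)))
·-congˡ≡ {f} {f′} g (suc n) h = ≡.trans (·-suc f g n) (≡.trans
  (≡.cong₂ (λ a b → a ℤ.* g (suc n) ℤ.+ b) (h 0) (·-congˡ≡ g n (h ∘ suc))) (≡.sym (·-suc f′ g n)))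

·-assoc : ∀ f g h n → ((f · g) · h) n ≡ (f · (g · h)) n
·-assoc f g h zero = ≡.trans (·-zero (f · g) h) (≡.trans (≡.cong (ℤ._* h 0) (·-zero f g))
  (≡.trans (ℤₚ.*-assoc (f 0) (g 0) (h 0))
    (≡.sym (≡.trans (·-zero f (g · h)) (≡.cong (f 0 ℤ.*_) (·-zero g h))))))
·-assoc f g h (suc n) = begin
  ((f · g) · h) (suc n)
    ≡⟨ ·-suc (f · g) h n ⟩
  (f · g) 0 ℤ.* h (suc n) ℤ.+ (((f · g) ∘ suc) · h) n
    ≡⟨ ≡.cong₂ (λ a b → a ℤ.* h (suc n) ℤ.+ b) (·-zero f g)
         (≡.trans (·-congˡ≡ h n (·-suc f g)) (·-distribʳ (λ k → f 0 ℤ.* g (suc k)) ((f ∘ suc) · g) h n)) ⟩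
  f 0 ℤ.* g 0 ℤ.* h (suc n) ℤ.+ (((λ k → f 0 ℤ.* g (suc k)) · h) n ℤ.+ (((f ∘ suc) · g) · h) n)
    ≡⟨ ≡.cong₂ (λ a b → f 0 ℤ.* g 0 ℤ.* h (suc n) ℤ.+ (a ℤ.+ b))
         (·-scale (f 0) (g ∘ suc) h n) (·-assoc (f ∘ suc) g h n) ⟩
  f 0 ℤ.* g 0 ℤ.* h (suc n) ℤ.+ (f 0 ℤ.* ((g ∘ suc) · h) n ℤ.+ ((f ∘ suc) · (g · h)) n)
    ≡⟨ eq (f 0) (g 0) (h (suc n)) _ _ ⟩
  f 0 ℤ.* (g 0 ℤ.* h (suc n) ℤ.+ ((g ∘ suc) · h) n) ℤ.+ ((f ∘ suc) · (g · h)) n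
    ≡⟨ ≡.cong (λ z → f 0 ℤ.* z ℤ.+ ((f ∘ suc) · (g · h)) n) (·-suc g h n) ⟨
  f 0 ℤ.* (g · h) (suc n) ℤ.+ ((f ∘ suc) · (g · h)) n
    ≡⟨ ·-suc f (g · h) n ⟨
  (f · (g · h)) (suc n) ∎
  where
  open ≡.≡-Reasoning
  eq : ∀ a b c x y → a ℤ.* b ℤ.* c ℤ.+ (a ℤ.* x ℤ.+ y) ≡ a ℤ.* (b ℤ.* c ℤ.+ x) ℤ.+ y
  eq = ℤ-solve

0·≡0 : ∀ g n → ((λ _ → + 0) · g) n ≡ + 0
0·≡0 g zero    = ·-zero (λ _ → + 0) g
0·≡0 g (suc n) = ≡.trans (·-suc (λ _ → + 0) g n) (≡.trans (ℤₚ.+-identityˡ _) (0·≡0 g n))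

-- the coefficients of q^e
δ : ℕ → Series
δ zero            = one
δ (suc e) zero    = + 0
δ (suc e) (suc n) = δ e n

one·≡ : ∀ g n → (one · g) n ≡ g n
one·≡ g zero    = ≡.trans (·-zero one g) (ℤₚ.*-identityˡ _)
one·≡ g (suc n) = ≡.trans (·-suc one g n)
  (≡.trans (≡.cong₂ ℤ._+_ (ℤₚ.*-identityˡ (g (suc n))) (0·≡0 g n)) (ℤₚ.+-identityʳ (g (suc n))))

δ·-zero : ∀ e g → (δ (suc e) · g) 0 ≡ + 0
δ·-zero e g = ·-zero (δ (suc e)) g

δ·-suc : ∀ e g n → (δ (suc e) · g) (suc n) ≡ (δ e · g) n
δ·-suc e g n = ≡.trans (·-suc (δ (suc e)) g n) (ℤₚ.+-identityˡ _)

δ·-+ : ∀ e g m → (δ e · g) (e ℕ.+ m) ≡ g m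
δ·-+ zero    g m = one·≡ g m
δ·-+ (suc e) g m = ≡.trans (δ·-suc e g (e ℕ.+ m)) (δ·-+ e g m)

δ·-< : ∀ {n e} g → n ℕ.< e → (δ e · g) n ≡ + 0
δ·-< {zero}  {suc e} g _        = δ·-zero e g
δ·-< {suc n} {suc e} g (s≤s lt) = ≡.trans (δ·-suc e g n) (δ·-< g lt)

δ≡0 : ∀ e n → e ≢ n → δ e n ≡ + 0
δ≡0 zero    zero    h = ⊥-elim (h ≡.refl)
δ≡0 zero    (suc n) h = ≡.refl
δ≡0 (suc e) zero    h = ≡.refl
δ≡0 (suc e) (suc n) h = δ≡0 e n (h ∘ ≡.cong suc)

onePlus≡ : ∀ c k n → onePlus c (suc k) n ≡ one n ℤ.+ c ℤ.* δ (suc k) n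
onePlus≡ c k zero    = ≡.sym (≡.cong (λ z → + 1 ℤ.+ z) (ℤₚ.*-zeroʳ c))
onePlus≡ c k (suc n) = ≡.trans (go k n) (≡.sym (ℤₚ.+-identityˡ _))
  where
  go : ∀ k n → (if n ℕ.≡ᵇ k then c else + 0) ≡ c ℤ.* δ k n
  go zero    zero    = ≡.sym (ℤₚ.*-identityʳ c)
  go zero    (suc n) = ≡.sym (ℤₚ.*-zeroʳ c)
  go (suc k) zero    = ≡.sym (ℤₚ.*-zeroʳ c)
  go (suc k) (suc n) = go k n

-- The equation G = 1 + c q^(k+1) G, read on coefficients. Below degree k + 1 only the constant term
-- is present; from there on, lowering n by k + 1 keeps the remainder and reduces the quotient,
-- hence the power of c, by one.
geomInv≡ : ∀ c k n → geomInv c (suc k) n ≡ one n ℤ.+ c ℤ.* (δ (suc k) · geomInv c (suc k)) n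
geomInv≡ c k n with n ℕ.<? suc k
... | yes n<k = ≡.trans (small n n<k)
  (≡.sym (≡.trans (≡.cong (λ z → one n ℤ.+ c ℤ.* z) (δ·-< (geomInv c (suc k)) n<k))
    (≡.trans (≡.cong (λ z → one n ℤ.+ z) (ℤₚ.*-zeroʳ c)) (ℤₚ.+-identityʳ _))))
  where
  small : ∀ n → n ℕ.< suc k → geomInv c (suc k) n ≡ one n
  small zero    _  = ≡.refl
  small (suc n) lt rewrite m<n⇒m%n≡m lt = ≡.refl
... | no n≮k = ≡.subst (λ n → geomInv c (suc k) n ≡ one n ℤ.+ c ℤ.* (δ (suc k) · geomInv c (suc k)) n)
  (ℕₚ.m+[n∸m]≡n (ℕₚ.≮⇒≥ n≮k)) (large (n ℕ.∸ suc k))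
  where
  if-* : ∀ (b : Bool) (x y : ℤ) → x ≡ c ℤ.* y → (if b then x else + 0) ≡ c ℤ.* (if b then y else + 0)
  if-* true  x y e = e
  if-* false x y e = ≡.sym (ℤₚ.*-zeroʳ c)
  large : ∀ m → geomInv c (suc k) (suc k ℕ.+ m) ≡
    one (suc k ℕ.+ m) ℤ.+ c ℤ.* (δ (suc k) · geomInv c (suc k)) (suc k ℕ.+ m)
  large m = ≡.trans (≡.trans
    (≡.cong₂ (λ r d → if r ℕ.≡ᵇ 0 then c ℤ.^ d else + 0)
      (≡.trans (≡.cong (_% suc k) (ℕₚ.+-comm (suc k) m)) ([m+n]%n≡m%n m (suc k)))
      (≡.trans (m/n≡1+[m∸n]/n {suc k ℕ.+ m} {suc k} (ℕₚ.m≤m+n (suc k) m))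
        (≡.cong (λ d → suc (d / suc k)) (ℕₚ.m+n∸m≡n (suc k) m))))
    (if-* (m % suc k ℕ.≡ᵇ 0) _ _ ≡.refl))
    (≡.sym (≡.trans (ℤₚ.+-identityˡ _) (≡.cong (c ℤ.*_) (δ·-+ (suc k) (geomInv c (suc k)) m))))

·-∣ : ∀ f g n → (∀ k → k ℕ.≤ n → + 3 ℤ∣.∣ f k ℤ.* g (n ℕ.∸ k)) → + 3 ℤ∣.∣ (f · g) n
·-∣ f g zero    h = ∣-≡ (≡.sym (·-zero f g)) (h 0 z≤n)
·-∣ f g (suc n) h = ∣-≡ (≡.sym (·-suc f g n)) (ℤ∣.∣m∣n⇒∣m+n (h 0 z≤n)
  (·-∣ (f ∘ suc) g n λ k le → h (suc k) (s≤s le)))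

-- Without η the ring operations stay folded; unfolded Cauchy products are
-- intractable for the conversion checker.
record PowerSeries : Set where
  no-eta-equality
  constructor ⟦_⟧
  field coeff : Series
open PowerSeries

-- F₃[q] / (q^{M+1})
module Truncated (M : ℕ) where

  infix 4 _≋_
  -- The quotient by 3 and q^(M+1) is taken in the equality alone. Elements remain integer series,
  -- so `S9bar` is literally one of their coefficients.
  record _≋_ (f g : PowerSeries) : Set where
    constructor eq
    field at : ∀ n → n ℕ.≤ M → coeff f n ≡₃ coeff g n
  open _≋_

  pointwise : ∀ {f g} → (∀ n → coeff f n ≡ coeff g n) → f ≋ g
  pointwise h = eq λ n _ → ≡₃-reflexive (h n)

  infixl 7 _⊠_
  infixl 6 _⊞_
  _⊞_ _⊠_ : PowerSeries → PowerSeries → PowerSeries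
  coeff (f ⊞ g) n = coeff f n ℤ.+ coeff g n
  coeff (f ⊠ g) = coeff f · coeff g

  ⊟_ : PowerSeries → PowerSeries
  coeff (⊟ f) n = ℤ.- coeff f n

  𝕆 𝕀 : PowerSeries
  coeff 𝕆 n = + 0
  coeff 𝕀 = one

  ⊠-cong : ∀ {f f′ g g′} → f ≋ f′ → g ≋ g′ → f ⊠ g ≋ f′ ⊠ g′
  ⊠-cong {f} {f′} {g} {g′} h k = eq λ n n≤M → go (coeff f) (coeff f′) n
    (λ j j≤n → at h j (ℕₚ.≤-trans j≤n n≤M)) (λ j j≤n → at k j (ℕₚ.≤-trans j≤n n≤M))
    where
    go : ∀ f f′ n → (∀ j → j ℕ.≤ n → f j ≡₃ f′ j) → (∀ j → j ℕ.≤ n → coeff g j ≡₃ coeff g′ j) →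
      (f · coeff g) n ≡₃ (f′ · coeff g′) n
    go f f′ zero h k = ≡.subst₂ _≡₃_ (≡.sym (·-zero f (coeff g))) (≡.sym (·-zero f′ (coeff g′)))
      (≡₃-* {f 0} {f′ 0} (h 0 z≤n) (k 0 z≤n))
    go f f′ (suc n) h k = ≡.subst₂ _≡₃_ (≡.sym (·-suc f (coeff g) n)) (≡.sym (·-suc f′ (coeff g′) n))
      (≡₃-+ {f 0 ℤ.* coeff g (suc n)} {f′ 0 ℤ.* coeff g′ (suc n)}
        (≡₃-* {f 0} {f′ 0} (h 0 z≤n) (k (suc n) ℕₚ.≤-refl))
        (go (f ∘ suc) (f′ ∘ suc) n (λ j le → h (suc j) (s≤s le)) (λ j le → k j (ℕₚ.m≤n⇒m≤1+n le))))

  seriesRing : CommutativeRing 0ℓ 0ℓ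
  seriesRing = record
    { Carrier = PowerSeries
    ; _≈_ = _≋_
    ; _+_ = _⊞_
    ; _*_ = _⊠_
    ; -_  = ⊟_
    ; 0#  = 𝕆
    ; 1#  = 𝕀
    ; isCommutativeRing = record
      { isRing = record
        { +-isAbelianGroup = record
          { isGroup = record
            { isMonoid = record
              { isSemigroup = record
                { isMagma = record
                  { isEquivalence = record
                    { refl  = pointwise λ _ → ≡.refl
                    ; sym   = λ {f} {g} h → eq λ n le → ≡₃-sym {coeff f n} (at h n le)
                    ; trans = λ {f} {g} p q → eq λ n le → ≡₃-trans {coeff f n} {coeff g n} (at p n le) (at q n le)
                    }
                  ; ∙-cong = λ {f} {f′} p q → eq λ n le → ≡₃-+ {coeff f n} {coeff f′ n} (at p n le) (at q n le)
                  }
                ; assoc = λ f g h → pointwise λ n → ℤₚ.+-assoc (coeff f n) (coeff g n) (coeff h n)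
                }
              ; identity = (λ f → pointwise λ n → ℤₚ.+-identityˡ (coeff f n))
                , (λ f → pointwise λ n → ℤₚ.+-identityʳ (coeff f n))
              }
            ; inverse = (λ f → pointwise λ n → ℤₚ.+-inverseˡ (coeff f n))
              , (λ f → pointwise λ n → ℤₚ.+-inverseʳ (coeff f n))
            ; ⁻¹-cong = λ {f} h → eq λ n le → ≡₃-neg {coeff f n} (at h n le)
            }
          ; comm = λ f g → pointwise λ n → ℤₚ.+-comm (coeff f n) (coeff g n)
          }
        ; *-cong = ⊠-cong
        ; *-assoc = λ f g h → pointwise (·-assoc (coeff f) (coeff g) (coeff h))
        ; *-identity = (λ f → pointwise (one·≡ (coeff f)))
          , (λ f → pointwise λ n → ≡.trans (·-comm (coeff f) one n) (one·≡ (coeff f) n))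
        ; distrib = (λ f g h → pointwise λ n → ≡.trans (·-comm (coeff f) (coeff (g ⊞ h)) n) (≡.trans
              (·-distribʳ (coeff g) (coeff h) (coeff f) n)
              (≡.cong₂ ℤ._+_ (·-comm (coeff g) (coeff f) n) (·-comm (coeff h) (coeff f) n))))
          , (λ f g h → pointwise (·-distribʳ (coeff g) (coeff h) (coeff f)))
        }
      ; *-comm = λ f g → pointwise (·-comm (coeff f) (coeff g))
      }
    }

  three≋0 : Characteristic3 seriesRing
  three≋0 = eq λ { zero _ → divides (+ 1) ≡.refl ; (suc n) _ → divides (+ 0) ≡.refl }

  -- The defining product in the truncated ring

  open Char3 seriesRing three≋0
  open Theta M

  q : PowerSeries
  q = ⟦ δ 1 ⟧

  q^≡δ : ∀ e n → coeff (q ^ e) n ≡ δ e n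
  q^≡δ zero    n       = ≡.refl
  q^≡δ (suc e) zero    = δ·-zero 0 (coeff (q ^ e))
  q^≡δ (suc e) (suc n) = ≡.trans (δ·-suc 0 (coeff (q ^ e)) n)
    (≡.trans (one·≡ (coeff (q ^ e)) n) (q^≡δ e n))

  q^≡0 : ∀ e n → e ≢ n → coeff (q ^ e) n ≡ + 0
  q^≡0 e n e≢n = ≡.trans (q^≡δ e n) (δ≡0 e n e≢n)

  q-nil : Nil q
  q-nil = eq λ n n≤M → ≡₃-reflexive (q^≡0 (suc M) n λ { ≡.refl → ℕₚ.<-irrefl ≡.refl n≤M })

  private
    δ≈ : ∀ e → ⟦ δ e ⟧ ≈ q ^ e
    δ≈ e = pointwise λ n → ≡.sym (q^≡δ e n)

    plus : ∀ j → ⟦ onePlus (+ 1) (suc j) ⟧ ≈ 1# + q ^ suc j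
    plus j = trans {j = 1# + ⟦ δ (suc j) ⟧} (pointwise λ n → ≡.trans (onePlus≡ (+ 1) j n)
      (≡.cong (λ z → one n ℤ.+ z) (ℤₚ.*-identityˡ _))) (+-congˡ (δ≈ (suc j)))

    minus : ∀ j → ⟦ onePlus (ℤ.- + 1) (suc j) ⟧ ≈ 1# - q ^ suc j
    minus j = trans {j = 1# - ⟦ δ (suc j) ⟧} (pointwise λ n → ≡.trans (onePlus≡ (ℤ.- + 1) j n)
      (≡.cong (λ z → one n ℤ.+ z) (ℤₚ.-1*i≡-i _))) (+-congˡ (-‿cong (δ≈ (suc j))))

    geom⁺ : ∀ j → (1# - q ^ suc j) * ⟦ geomInv (+ 1) (suc j) ⟧ ≈ 1#
    geom⁺ j = inverse⁺ (trans {j = 1# + ⟦ δ (suc j) ⟧ * G} (pointwise λ n → ≡.trans (geomInv≡ (+ 1) j n)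
      (≡.cong (λ z → one n ℤ.+ z) (ℤₚ.*-identityˡ _))) (+-congˡ (*-congʳ (δ≈ (suc j)))))
      where
      G : PowerSeries
      G = ⟦ geomInv (+ 1) (suc j) ⟧

    geom⁻ : ∀ j → (1# + q ^ suc j) * ⟦ geomInv (ℤ.- + 1) (suc j) ⟧ ≈ 1#
    geom⁻ j = inverse⁻ (trans {j = 1# - ⟦ δ (suc j) ⟧ * G} (pointwise λ n → ≡.trans (geomInv≡ (ℤ.- + 1) j n)
      (≡.cong (λ z → one n ℤ.+ z) (ℤₚ.-1*i≡-i _))) (+-congˡ (-‿cong (*-congʳ (δ≈ (suc j))))))
      where
      G : PowerSeries
      G = ⟦ geomInv (ℤ.- + 1) (suc j) ⟧

    factor′ : ℕ → PowerSeries
    factor′ o = ⟦ onePlus (+ 1) o ⟧ * ⟦ onePlus (ℤ.- + 1) (9 ℕ.* o) ⟧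
      * ⟦ geomInv (ℤ.- + 1) (9 ℕ.* o) ⟧ * ⟦ geomInv (+ 1) o ⟧

    factor′-8 : ∀ o k → o ≡ suc k → factor′ o * (1# + q ^ o) ^ 8 ≈ (1# - q ^ o) ^ 8
    factor′-8 o k ≡.refl = factor-8 (plus k)
      (trans (minus (k ℕ.+ 8 ℕ.* suc k)) (+-congˡ (-‿cong q⁹)))
      (trans (*-congʳ (+-congˡ (sym q⁹))) (geom⁻ (k ℕ.+ 8 ℕ.* suc k)))
      (geom⁺ k)
      where
      q⁹ : q ^ (9 ℕ.* o) ≈ (q ^ o) ^ 9
      q⁹ = trans (^-≡ q (ℕₚ.*-comm 9 o)) (sym (^-assocʳ q o 9))

    partialProd≈∏ : ∀ N → ⟦ partialProd N ⟧ ≈ ∏ (λ j → factor′ (j ℕ.+ suc (j ℕ.+ 0))) N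
    partialProd≈∏ zero    = pointwise λ _ → ≡.refl
    partialProd≈∏ (suc N) = trans {j = ⟦ partialProd N ⟧ * factor′ (N ℕ.+ suc (N ℕ.+ 0))}
      (pointwise λ _ → ≡.refl) (*-congʳ (partialProd≈∏ N))

  partialProd-8 : ∀ N → ⟦ partialProd N ⟧ * PochOdd (- q) N ^ 8 ≈ PochOdd q N ^ 8
  partialProd-8 N = trans (*-congʳ (partialProd≈∏ N)) (∏-PochOdd-8 _
    (λ j → factor′-8 _ _ (ℕₚ.+-suc j (j ℕ.+ 0))) N)

  -- f ∈ F₃[q³]
  Cubic : PowerSeries → Set
  Cubic f = ∀ n → n ℕ.≤ M → ¬ 3 ℕ∣.∣ n → + 3 ℤ∣.∣ coeff f n

  ≋-∣ : ∀ {f g n} → f ≋ g → n ℕ.≤ M → + 3 ℤ∣.∣ coeff f n → + 3 ℤ∣.∣ coeff g n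
  ≋-∣ {f} {g} {n} h le d = ≡₃0⇒∣ (≡₃-trans {coeff g n} {coeff f n} {+ 0}
    (≡₃-sym {coeff f n} {coeff g n} (at h n le)) (∣⇒≡₃0 d))

  cubic-subring : IsSubring Cubic
  cubic-subring = record
    { resp = λ h p n le 3∤n → ≋-∣ h le (p n le 3∤n)
    ; 1-closed = λ { zero _ 3∤n → ⊥-elim (3∤n (ℕ∣.divides 0 ≡.refl)) ; (suc n) _ _ → divides (+ 0) ≡.refl }
    ; neg-closed = λ p n le 3∤n → ℤ∣.∣m⇒∣-m (p n le 3∤n)
    ; +-closed = λ p r n le 3∤n → ℤ∣.∣m∣n⇒∣m+n (p n le 3∤n) (r n le 3∤n)
    ; *-closed = λ {f} {g} p r n le 3∤n →
        ·-∣ (coeff f) (coeff g) n λ k k≤n → product f g p r n le 3∤n k k≤n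
    }
    where
    -- If 3 does not divide n, it cannot divide both k and n - k, so every term of the convolution
    -- has a factor divisible by 3.
    product : ∀ f g → Cubic f → Cubic g → ∀ n → n ℕ.≤ M → ¬ 3 ℕ∣.∣ n → ∀ k → k ℕ.≤ n →
      + 3 ℤ∣.∣ coeff f k ℤ.* coeff g (n ℕ.∸ k)
    product f g p r n le 3∤n k k≤n with 3 ℕ∣.∣? k
    ... | yes 3∣k = ℤ∣.∣n⇒∣m*n (coeff f k) (r (n ℕ.∸ k) (ℕₚ.≤-trans (ℕₚ.m∸n≤m n k) le)
      λ d → 3∤n (≡.subst (3 ℕ∣.∣_) (ℕₚ.m+[n∸m]≡n k≤n) (ℕ∣.∣m∣n⇒∣m+n 3∣k d)))
    ... | no 3∤k = ℤ∣.∣m⇒∣m*n (coeff g (n ℕ.∸ k)) (p k (ℕₚ.≤-trans k≤n le) 3∤k)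

  q³-cubic : Cubic (q ^ 3)
  q³-cubic n _ 3∤n = ∣-≡ (≡.sym (q^≡0 3 n λ { ≡.refl → 3∤n (ℕ∣.divides 1 ≡.refl) })) (divides (+ 0) ≡.refl)

  -- The coefficient of q^M for M congruent to 1 mod 3

  module _ (j : ℕ) (M≡ : M ≡ 1 ℕ.+ 3 ℕ.* j)
    (unrepresented : ∀ u v → 1 ℕ.+ (3 ℕ.* pent u ℕ.+ 9 ℕ.* pent v) ≢ M) where

    private
      Vanishes : PowerSeries → Set
      Vanishes f = + 3 ℤ∣.∣ coeff f M

      resp : ∀ {f g} → f ≈ g → Vanishes f → Vanishes g
      resp h = ≋-∣ h ℕₚ.≤-refl

      vanishes-∑ : ∀ {g} L → (∀ k → Vanishes (g k)) → Vanishes (∑ L g)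
      vanishes-∑ zero    h = h (+ 0)
      vanishes-∑ (suc L) h = ℤ∣.∣m∣n⇒∣m+n (vanishes-∑ L h) (ℤ∣.∣m∣n⇒∣m+n (h (+ suc L)) (h -[1+ L ]))

      vanishes-neg : ∀ f → Vanishes f → Vanishes (- 1# * f)
      vanishes-neg f h = resp (sym (neg-1* f)) (ℤ∣.∣m⇒∣-m h)

      -- Vanishing of one coefficient is additive but not stable under multiplication, so signs are
      -- stripped off one factor `- 1#` at a time.
      vanishes-sign : ∀ f n → Vanishes f → Vanishes (-1^ n * f)
      vanishes-sign f zero    h = resp (sym (*-identityˡ f)) h
      vanishes-sign f (suc n) h = resp (sym (*-assoc (- 1#) (-1^ n) f))
        (vanishes-neg (-1^ n * f) (vanishes-sign f n h))

      f g : ℤ → PowerSeries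
      f u = sgn u * (q ^ 3) ^ pent u
      g v = sgn v * (q ^ 9) ^ pent v

      vanishes-term : ∀ u v → Vanishes (q * (f u * g v))
      vanishes-term u v = resp (sym (monomial q (sgn u) (sgn v) (pent u) (pent v)))
        (vanishes-sign (sgn v * q ^ e) ∣ u ∣ (vanishes-sign (q ^ e) ∣ v ∣
          (∣-≡ (≡.sym (q^≡0 e M (unrepresented u v))) (divides (+ 0) ≡.refl))))
        where
        e : ℕ
        e = 1 ℕ.+ (3 ℕ.* pent u ℕ.+ 9 ℕ.* pent v)

      vanishes-main : Vanishes (q * (∑ M f * ∑ M g))
      vanishes-main = resp (sym (trans (*-congˡ (∑*∑ f g)) (trans (sym (∑-*ˡ q _ M))
        (∑-cong M λ u → sym (∑-*ˡ q _ M)))))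
        (vanishes-∑ M λ u → vanishes-∑ M λ v → vanishes-term u v)

      3∤1 : ¬ 3 ℕ∣.∣ 1
      3∤1 d = ℕₚ.<⇒≱ (s≤s (s≤s z≤n)) (ℕ∣.∣⇒≤ d)

      3∤M : ¬ 3 ℕ∣.∣ M
      3∤M d = 3∤1 (ℕ∣.∣m+n∣m⇒∣n (≡.subst (3 ℕ∣.∣_) (≡.trans M≡ (ℕₚ.+-comm 1 (3 ℕ.* j))) d) (ℕ∣.m∣m*n j))

      vanishes-q² : ∀ S → Cubic S → Vanishes (q ^ 2 * S)
      vanishes-q² S hS = resp {⟦ δ 2 ⟧ * S} (*-congʳ {S} (δ≈ 2)) (coefficient M M≡ ℕₚ.≤-refl)
        where
        -- The coefficient in question is that of `S` at M - 2, which is 2 mod 3. For M = 1 the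
        -- shift by q² already passes the degree.
        coefficient : ∀ n → n ≡ 1 ℕ.+ 3 ℕ.* j → n ℕ.≤ M → + 3 ℤ∣.∣ (δ 2 · coeff S) n
        coefficient (suc zero)    _ _  = ∣-≡ (≡.sym (δ·-< {1} {2} (coeff S) (s≤s (s≤s z≤n)))) (divides (+ 0) ≡.refl)
        coefficient (suc (suc m)) e le = ∣-≡ (≡.sym (δ·-+ 2 (coeff S) m))
          (hS m (ℕₚ.≤-trans (ℕₚ.m≤n+m m 2) le) λ d → 3∤1 (ℕ∣.∣m+n∣m⇒∣n
            (≡.subst (3 ℕ∣.∣_) (≡.trans (≡.sym (ℕₚ.suc-injective e)) (ℕₚ.+-comm 1 m)) (ℕ∣.m∣m*n j)) d))

    -- `S9bar M` is by definition the coefficient of q^M in the product of M factors. Since M is 1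
    -- mod 3, neither `S₀` nor `q ^ 2 * S₂` reaches it, and the main term has no exponent equal to
    -- M.
    S9bar-vanishes : + 3 ℤ∣.∣ S9bar M
    S9bar-vanishes = conclude (generating-function cubic-subring q-nil q³-cubic (partialProd-8 M))
      where
      conclude : (Σ PowerSeries λ S₀ → Σ PowerSeries λ S₂ → Cubic S₀ × Cubic S₂ ×
        ⟦ partialProd M ⟧ ≈ (1# + 1#) * (q * (∑ M f * ∑ M g)) + (S₀ + q ^ 2 * S₂)) → + 3 ℤ∣.∣ S9bar M
      conclude (S₀ , S₂ , hS₀ , hS₂ , G≈) =
        resp (sym (trans G≈ (+-congʳ (double-+ _))))
          (ℤ∣.∣m∣n⇒∣m+n (ℤ∣.∣m∣n⇒∣m+n vanishes-main vanishes-main)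
            (ℤ∣.∣m∣n⇒∣m+n (hS₀ M ℕₚ.≤-refl 3∤M) (vanishes-q² S₂ hS₂)))

-- Values of a² + 3b²

OneMod3 : ℕ → Set
OneMod3 n = ∃ λ j → n ≡ 1 ℕ.+ 3 ℕ.* j

OneMod3-* : ∀ {m n} → OneMod3 m → OneMod3 n → OneMod3 (m ℕ.* n)
OneMod3-* (i , ≡.refl) (j , ≡.refl) = i ℕ.+ j ℕ.+ 3 ℕ.* (i ℕ.* j) , eq i j
  where
  eq : ∀ i j → (1 ℕ.+ 3 ℕ.* i) ℕ.* (1 ℕ.+ 3 ℕ.* j) ≡ 1 ℕ.+ 3 ℕ.* (i ℕ.+ j ℕ.+ 3 ℕ.* (i ℕ.* j))
  eq = ℕ-solve

OneMod3-^ : ∀ {m} → OneMod3 m → ∀ k → OneMod3 (m ℕ.^ k)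
OneMod3-^ h zero    = 0 , ≡.refl
OneMod3-^ h (suc k) = OneMod3-* h (OneMod3-^ h k)

3∣⊎square≡1 : ∀ n → (∃ λ j → n ≡ 3 ℕ.* j) ⊎ (OneMod3 (n ℕ.* n))
3∣⊎square≡1 zero = inj₁ (0 , ≡.refl)
3∣⊎square≡1 (suc zero) = inj₂ (0 , ≡.refl)
3∣⊎square≡1 (suc (suc zero)) = inj₂ (1 , ≡.refl)
3∣⊎square≡1 (suc (suc (suc n))) with 3∣⊎square≡1 n
... | inj₁ (j , ≡.refl) = inj₁ (suc j , eq j)
  where
  eq : ∀ j → 3 ℕ.+ 3 ℕ.* j ≡ 3 ℕ.* (1 ℕ.+ j)
  eq = ℕ-solve
... | inj₂ (j , e) = inj₂ (3 ℕ.+ 2 ℕ.* n ℕ.+ j , ≡.trans (eq₁ n) (≡.trans (≡.cong (λ x → 9 ℕ.+ 6 ℕ.* n ℕ.+ x) e) (eq₂ n j)))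
  where
  eq₁ : ∀ n → (3 ℕ.+ n) ℕ.* (3 ℕ.+ n) ≡ 9 ℕ.+ 6 ℕ.* n ℕ.+ n ℕ.* n
  eq₁ = ℕ-solve
  eq₂ : ∀ n j → 9 ℕ.+ 6 ℕ.* n ℕ.+ (1 ℕ.+ 3 ℕ.* j) ≡ 1 ℕ.+ 3 ℕ.* (3 ℕ.+ 2 ℕ.* n ℕ.+ j)
  eq₂ = ℕ-solve

module Inert {p : ℕ} (isPrime : Prime p) (5≤p : 5 ℕ.≤ p) (inert : LegendreIsMinusOne (ℤ.- + 3) p) where

  private instance
    p≢0 : ℕ.NonZero p
    p≢0 = prime⇒nonZero isPrime

  p∤small : ∀ k → 1 ℕ.≤ k → k ℕ.< 5 → ¬ p ℕ∣.∣ k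
  p∤small (suc k) _ k<5 d = ℕₚ.<⇒≱ (ℕₚ.<-≤-trans k<5 5≤p) (ℕ∣.∣⇒≤ d)

  p∣*⇒ : ∀ a b → + p ℤ∣.∣ a ℤ.* b → (+ p ℤ∣.∣ a) ⊎ (+ p ℤ∣.∣ b)
  p∣*⇒ a b d with euclidsLemma ∣ a ∣ ∣ b ∣ isPrime (≡.subst (p ℕ∣.∣_) (ℤₚ.abs-* a b) (ℤ∣.∣⇒∣ᵤ d))
  ... | inj₁ h = inj₁ (ℤ∣.∣ᵤ⇒∣ h)
  ... | inj₂ h = inj₂ (ℤ∣.∣ᵤ⇒∣ h)

  p∣²⇒ : ∀ a → + p ℤ∣.∣ a ℤ.* a → + p ℤ∣.∣ a
  p∣²⇒ a d = [ (λ h → h) , (λ h → h) ]′ (p∣*⇒ a a d)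

  +∣⇒∣ : ∀ {n} → + p ℤ∣.∣ + n → p ℕ∣.∣ n
  +∣⇒∣ = ℤ∣.∣⇒∣ᵤ

  -- An inverse up to sign is enough, as it will only be squared. Both forms of Bézout's identity
  -- and both signs of `b` are thereby covered.
  inverse : ∀ b → ¬ + p ℤ∣.∣ b → ∃ λ c → + p ℤ∣.∣ (c ℤ.* b) ℤ.* (c ℤ.* b) ℤ.- + 1
  inverse b p∤b = bézout (coprime-Bézout coprime)
    where
    n : ℕ
    n = ∣ b ∣
    coprime : Coprime p n
    coprime {d} (d∣p , d∣n) with prime⇒irreducible isPrime d∣p
    ... | inj₁ d≡1 = d≡1
    ... | inj₂ ≡.refl = ⊥-elim (p∤b (ℤ∣.∣ᵤ⇒∣ d∣n))
    +n² : + n ℤ.* + n ≡ b ℤ.* b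
    +n² = square b
      where
      square : ∀ b → + ∣ b ∣ ℤ.* + ∣ b ∣ ≡ b ℤ.* b
      square (+ m)    = ≡.refl
      square -[1+ m ] = ≡.refl
    finish : ∀ y → + p ℤ∣.∣ (+ y ℤ.* + n) ℤ.* (+ y ℤ.* + n) ℤ.- + 1 →
      + p ℤ∣.∣ (+ y ℤ.* b) ℤ.* (+ y ℤ.* b) ℤ.- + 1
    finish y = ≡.subst (+ p ℤ∣.∣_) (≡.cong (ℤ._- + 1) (≡.trans (eq (+ y) (+ n))
      (≡.trans (≡.cong (+ y ℤ.* + y ℤ.*_) +n²) (≡.sym (eq (+ y) b)))))
      where
      eq : ∀ y b → (y ℤ.* b) ℤ.* (y ℤ.* b) ≡ y ℤ.* y ℤ.* (b ℤ.* b)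
      eq = ℤ-solve
    bézout : Bézout.Identity 1 p n → ∃ λ c → + p ℤ∣.∣ (c ℤ.* b) ℤ.* (c ℤ.* b) ℤ.- + 1
    bézout (Bézout.+- x y e) = + y , finish y
      (≡.subst (+ p ℤ∣.∣_) (eq (+ y ℤ.* + n)) (ℤ∣.∣m⇒∣m*n (+ y ℤ.* + n ℤ.- + 1) (divides (+ x) e′)))
      where
      e′ : + 1 ℤ.+ + y ℤ.* + n ≡ + x ℤ.* + p
      e′ = ≡.trans (≡.cong (λ i → + 1 ℤ.+ i) (≡.sym (ℤₚ.pos-* y n)))
        (≡.trans (≡.cong +_ e) (ℤₚ.pos-* x p))
      eq : ∀ z → (+ 1 ℤ.+ z) ℤ.* (z ℤ.- + 1) ≡ z ℤ.* z ℤ.- + 1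
      eq = ℤ-solve
    bézout (Bézout.-+ x y e) = + y , finish y
      (≡.subst (+ p ℤ∣.∣_) (eq (+ y ℤ.* + n)) (ℤ∣.∣m⇒∣m*n (+ y ℤ.* + n ℤ.+ + 1) (divides (+ x) e′)))
      where
      e″ : + 1 ℤ.+ + x ℤ.* + p ≡ + y ℤ.* + n
      e″ = ≡.trans (≡.cong (λ i → + 1 ℤ.+ i) (≡.sym (ℤₚ.pos-* x p)))
        (≡.trans (≡.cong +_ e) (ℤₚ.pos-* y n))
      sub : ∀ z → + 1 ℤ.+ z ℤ.- + 1 ≡ z
      sub = ℤ-solve
      e′ : + y ℤ.* + n ℤ.- + 1 ≡ + x ℤ.* + p
      e′ = ≡.trans (≡.cong (ℤ._- + 1) (≡.sym e″)) (sub (+ x ℤ.* + p))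
      eq : ∀ z → (z ℤ.- + 1) ℤ.* (z ℤ.+ + 1) ≡ z ℤ.* z ℤ.- + 1
      eq = ℤ-solve

  form : ℤ → ℤ → ℤ
  form a b = a ℤ.* a ℤ.+ + 3 ℤ.* (b ℤ.* b)

  -- Otherwise dividing a² + 3b² by b² modulo p exhibits -3 as the square of c a, where c inverts b
  -- up to sign.
  p∣form⇒p∣b : ∀ a b → + p ℤ∣.∣ form a b → + p ℤ∣.∣ b
  p∣form⇒p∣b a b d with + p ℤ∣.∣? b
  ... | yes p∣b = p∣b
  ... | no p∤b with inverse b p∤b
  ...   | c , cb≡1 = ⊥-elim (proj₂ inert (c ℤ.* a , ℤ∣.∣⇒∣ᵤ (≡.subst (+ p ℤ∣.∣_) (eq a b c)
            (ℤ∣.∣m∣n⇒∣m-n (ℤ∣.∣n⇒∣m*n (c ℤ.* c) d) (ℤ∣.∣n⇒∣m*n (+ 3) cb≡1)))))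
    where
    eq : ∀ a b c → c ℤ.* c ℤ.* (a ℤ.* a ℤ.+ + 3 ℤ.* (b ℤ.* b)) ℤ.-
      + 3 ℤ.* ((c ℤ.* b) ℤ.* (c ℤ.* b) ℤ.- + 1) ≡ (c ℤ.* a) ℤ.* (c ℤ.* a) ℤ.- (ℤ.- + 3)
    eq = ℤ-solve

  p∣form⇒p∣a : ∀ a b → + p ℤ∣.∣ form a b → + p ℤ∣.∣ a
  p∣form⇒p∣a a b d = p∣²⇒ a (ℤ∣.∣m+n∣n⇒∣m d
    (ℤ∣.∣n⇒∣m*n (+ 3) (ℤ∣.∣m⇒∣m*n b (p∣form⇒p∣b a b d))))

  -- Both a and b are multiples of p, so the form carries p², and one p is cancelled against the
  -- given one.
  descend : ∀ a b n → form a b ≡ + (p ℕ.* n) → ∃ λ a′ → ∃ λ b′ → + p ℤ.* form a′ b′ ≡ + n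
  descend a b n h = go (p∣form⇒p∣a a b p∣form) (p∣form⇒p∣b a b p∣form)
    where
    p∣form : + p ℤ∣.∣ form a b
    p∣form = divides (+ n) (≡.trans h (≡.trans (ℤₚ.pos-* p n) (ℤₚ.*-comm (+ p) (+ n))))
    eq : ∀ a b p → p ℤ.* (p ℤ.* (a ℤ.* a ℤ.+ + 3 ℤ.* (b ℤ.* b))) ≡
      (a ℤ.* p) ℤ.* (a ℤ.* p) ℤ.+ + 3 ℤ.* ((b ℤ.* p) ℤ.* (b ℤ.* p))
    eq = ℤ-solve
    go : + p ℤ∣.∣ a → + p ℤ∣.∣ b → ∃ λ a′ → ∃ λ b′ → + p ℤ.* form a′ b′ ≡ + n
    go (divides a′ ≡.refl) (divides b′ ≡.refl) = a′ , b′ , ℤₚ.*-cancelˡ-≡ (+ p) (+ p ℤ.* form a′ b′) (+ n)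
      (≡.trans (eq a′ b′ (+ p)) (≡.trans h (ℤₚ.pos-* p n)))

  -- Descent: dividing a and b by p removes p² from the value. With a single p left, the same
  -- division would make m a multiple of p.
  odd-power-unrepresented : ∀ α m → ¬ p ℕ∣.∣ m → ∀ a b → form a b ≢ + (p ℕ.^ suc (2 ℕ.* α) ℕ.* m)
  odd-power-unrepresented zero m p∤m a b h = p∤m (p∣m
    (descend a b m (≡.trans h (≡.cong (λ k → + (k ℕ.* m)) (ℕₚ.*-identityʳ p)))))
    where
    p∣m : (∃ λ a′ → ∃ λ b′ → + p ℤ.* form a′ b′ ≡ + m) → p ℕ∣.∣ m
    p∣m (a′ , b′ , e) = +∣⇒∣ (divides (form a′ b′) (≡.trans (≡.sym e) (ℤₚ.*-comm (+ p) (form a′ b′))))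
  odd-power-unrepresented (suc α) m p∤m a b h = smaller
    (descend a b (p ℕ.* k) (≡.trans h (≡.cong +_ (≡.trans
      (≡.cong (λ j → p ℕ.^ suc j ℕ.* m) (ℕₚ.*-suc 2 α)) (eq p (p ℕ.^ (2 ℕ.* α)) m)))))
    where
    k : ℕ
    k = p ℕ.^ suc (2 ℕ.* α) ℕ.* m
    eq : ∀ p x m → p ℕ.* (p ℕ.* (p ℕ.* x)) ℕ.* m ≡ p ℕ.* (p ℕ.* (p ℕ.* x ℕ.* m))
    eq = ℕ-solve
    smaller : (∃ λ a′ → ∃ λ b′ → + p ℤ.* form a′ b′ ≡ + (p ℕ.* k)) → ⊥
    smaller (a′ , b′ , e) = odd-power-unrepresented α m p∤m a′ b′
      (ℤₚ.*-cancelˡ-≡ (+ p) (form a′ b′) (+ k) (≡.trans e (ℤₚ.pos-* p k)))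

  -- Modulo p the number is 6i, and p ≥ 5 divides neither 6 nor an i strictly between 0 and p.
  p∤6i+p+ : ∀ n i → 1 ℕ.≤ i → i ℕ.< p → ¬ p ℕ∣.∣ 6 ℕ.* p ℕ.* n ℕ.+ (6 ℕ.* i ℕ.+ p)
  p∤6i+p+ n i 1≤i i<p d with euclidsLemma 6 i isPrime (ℕ∣.∣m+n∣m⇒∣n
    (≡.subst (p ℕ∣.∣_) (ℕₚ.+-comm (6 ℕ.* i) p) (ℕ∣.∣m+n∣m⇒∣n d p∣6pn)) ℕ∣.∣-refl)
    where
    p∣6pn : p ℕ∣.∣ 6 ℕ.* p ℕ.* n
    p∣6pn = ℕ∣.∣m⇒∣m*n n (ℕ∣.n∣m*n 6)
  ... | inj₁ p∣6 with euclidsLemma 2 3 isPrime p∣6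
  ...   | inj₁ p∣2 = p∤small 2 (s≤s z≤n) (s≤s (s≤s (s≤s z≤n))) p∣2
  ...   | inj₂ p∣3 = p∤small 3 (s≤s z≤n) (s≤s (s≤s (s≤s (s≤s z≤n)))) p∣3
  p∤6i+p+ n (suc i) 1≤i i<p d | inj₂ p∣i = ℕₚ.<⇒≱ i<p (ℕ∣.∣⇒≤ p∣i)

  -- 4 (1 + 3 pent u + 9 pent v) = (6u - 1)² + 3 (6v - 1)²
  pent-unrepresented : ∀ α m → ¬ p ℕ∣.∣ m → ∀ u v →
    1 ℕ.+ (3 ℕ.* pent u ℕ.+ 9 ℕ.* pent v) ≢ p ℕ.^ suc (2 ℕ.* α) ℕ.* m
  -- The factor 4 is moved into the cofactor, which stays prime to p because p ≥ 5.
  pent-unrepresented α m p∤m u v h = odd-power-unrepresented α (4 ℕ.* m) p∤4m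
    (+ 6 ℤ.* u ℤ.- + 1) (+ 6 ℤ.* v ℤ.- + 1) (begin
      form (+ 6 ℤ.* u ℤ.- + 1) (+ 6 ℤ.* v ℤ.- + 1)
        ≡⟨ eq u v ⟩
      + 4 ℤ.* (+ 1 ℤ.+ (+ 3 ℤ.* (u ℤ.* (+ 3 ℤ.* u ℤ.- + 1)) ℤ.+ + 9 ℤ.* (v ℤ.* (+ 3 ℤ.* v ℤ.- + 1))))
        ≡⟨ ≡.cong₂ (λ x y → + 4 ℤ.* (+ 1 ℤ.+ (x ℤ.+ y)))
             (≡.trans (ℤₚ.pos-* 3 (pent u)) (≡.cong (+ 3 ℤ.*_) (+pent u)))
             (≡.trans (ℤₚ.pos-* 9 (pent v)) (≡.cong (+ 9 ℤ.*_) (+pent v))) ⟨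
      + 4 ℤ.* + (1 ℕ.+ (3 ℕ.* pent u ℕ.+ 9 ℕ.* pent v))
        ≡⟨ ≡.cong (λ k → + 4 ℤ.* + k) h ⟩
      + 4 ℤ.* + (p ℕ.^ suc (2 ℕ.* α) ℕ.* m)
        ≡⟨ ℤₚ.pos-* 4 (p ℕ.^ suc (2 ℕ.* α) ℕ.* m) ⟨
      + (4 ℕ.* (p ℕ.^ suc (2 ℕ.* α) ℕ.* m))
        ≡⟨ ≡.cong +_ (swap (p ℕ.^ suc (2 ℕ.* α)) m) ⟩
      + (p ℕ.^ suc (2 ℕ.* α) ℕ.* (4 ℕ.* m)) ∎)
    where
    open ≡.≡-Reasoning
    eq : ∀ u v → (+ 6 ℤ.* u ℤ.- + 1) ℤ.* (+ 6 ℤ.* u ℤ.- + 1) ℤ.+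
      + 3 ℤ.* ((+ 6 ℤ.* v ℤ.- + 1) ℤ.* (+ 6 ℤ.* v ℤ.- + 1)) ≡
      + 4 ℤ.* (+ 1 ℤ.+ (+ 3 ℤ.* (u ℤ.* (+ 3 ℤ.* u ℤ.- + 1)) ℤ.+ + 9 ℤ.* (v ℤ.* (+ 3 ℤ.* v ℤ.- + 1))))
    eq = ℤ-solve
    swap : ∀ x m → 4 ℕ.* (x ℕ.* m) ≡ x ℕ.* (4 ℕ.* m)
    swap = ℕ-solve
    p∤4m : ¬ p ℕ∣.∣ 4 ℕ.* m
    p∤4m d with euclidsLemma 4 m isPrime d
    ... | inj₁ p∣4 = p∤small 4 (s≤s z≤n) ℕₚ.≤-refl p∣4
    ... | inj₂ p∣m = p∤m p∣m

  p²≡1 : OneMod3 (p ℕ.* p)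
  p²≡1 with 3∣⊎square≡1 p
  ... | inj₂ h = h
  ... | inj₁ (j , e) with prime⇒irreducible isPrime (ℕ∣.divides {3} j (≡.trans e (ℕₚ.*-comm 3 j)))
  ...   | inj₂ ≡.refl = ⊥-elim (ℕₚ.<⇒≱ {3} (s≤s (s≤s (s≤s (s≤s z≤n)))) 5≤p)

  index : ∀ α n i → 6 ℕ.* p ℕ.^ (2 ℕ.* α ℕ.+ 2) ℕ.* n ℕ.+ (6 ℕ.* i ℕ.+ p) ℕ.* p ℕ.^ (2 ℕ.* α ℕ.+ 1) ≡
    p ℕ.^ suc (2 ℕ.* α) ℕ.* (6 ℕ.* p ℕ.* n ℕ.+ (6 ℕ.* i ℕ.+ p))
  index α n i = ≡.trans (≡.cong₂ (λ a b → 6 ℕ.* p ℕ.^ a ℕ.* n ℕ.+ (6 ℕ.* i ℕ.+ p) ℕ.* p ℕ.^ b)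
    (ℕₚ.+-comm (2 ℕ.* α) 2) (ℕₚ.+-comm (2 ℕ.* α) 1)) (eq p (p ℕ.^ (2 ℕ.* α)) n i)
    where
    eq : ∀ p x n i → 6 ℕ.* (p ℕ.* (p ℕ.* x)) ℕ.* n ℕ.+ (6 ℕ.* i ℕ.+ p) ℕ.* (p ℕ.* x) ≡
      p ℕ.* x ℕ.* (6 ℕ.* p ℕ.* n ℕ.+ (6 ℕ.* i ℕ.+ p))
    eq = ℕ-solve

  -- Expanding gives p^(2α+2) plus a multiple of 6, and p² is 1 mod 3.
  index-OneMod3 : ∀ α n i → OneMod3 (p ℕ.^ suc (2 ℕ.* α) ℕ.* (6 ℕ.* p ℕ.* n ℕ.+ (6 ℕ.* i ℕ.+ p)))
  index-OneMod3 α n i with OneMod3-* (OneMod3-^ p²≡1 α) p²≡1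
  ... | j , e = j ℕ.+ 2 ℕ.* (p ℕ.* p ℕ.^ (2 ℕ.* α) ℕ.* (p ℕ.* n ℕ.+ i)) , (begin
    p ℕ.* x ℕ.* (6 ℕ.* p ℕ.* n ℕ.+ (6 ℕ.* i ℕ.+ p))
      ≡⟨ eq₁ p x n i ⟩
    x ℕ.* (p ℕ.* p) ℕ.+ 3 ℕ.* (2 ℕ.* (p ℕ.* x ℕ.* (p ℕ.* n ℕ.+ i)))
      ≡⟨ ≡.cong (λ y → y ℕ.* (p ℕ.* p) ℕ.+ 3 ℕ.* (2 ℕ.* (p ℕ.* x ℕ.* (p ℕ.* n ℕ.+ i)))) x≡ ⟩
    (p ℕ.* p) ℕ.^ α ℕ.* (p ℕ.* p) ℕ.+ 3 ℕ.* (2 ℕ.* (p ℕ.* x ℕ.* (p ℕ.* n ℕ.+ i)))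
      ≡⟨ ≡.cong (ℕ._+ 3 ℕ.* (2 ℕ.* (p ℕ.* x ℕ.* (p ℕ.* n ℕ.+ i)))) e ⟩
    1 ℕ.+ 3 ℕ.* j ℕ.+ 3 ℕ.* (2 ℕ.* (p ℕ.* x ℕ.* (p ℕ.* n ℕ.+ i)))
      ≡⟨ ≡.cong suc (ℕₚ.*-distribˡ-+ 3 j _) ⟨
    1 ℕ.+ 3 ℕ.* (j ℕ.+ 2 ℕ.* (p ℕ.* x ℕ.* (p ℕ.* n ℕ.+ i))) ∎)
    where
    open ≡.≡-Reasoning
    x : ℕ
    x = p ℕ.^ (2 ℕ.* α)
    x≡ : x ≡ (p ℕ.* p) ℕ.^ α
    x≡ = ≡.trans (≡.sym (ℕₚ.^-*-assoc p 2 α)) (≡.cong (λ k → (p ℕ.* k) ℕ.^ α) (ℕₚ.*-identityʳ p))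
    eq₁ : ∀ p x n i → p ℕ.* x ℕ.* (6 ℕ.* p ℕ.* n ℕ.+ (6 ℕ.* i ℕ.+ p)) ≡
      x ℕ.* (p ℕ.* p) ℕ.+ 3 ℕ.* (2 ℕ.* (p ℕ.* x ℕ.* (p ℕ.* n ℕ.+ i)))
    eq₁ = ℕ-solve

open import Data.Nat using (ℕ; _+_; _*_; _^_; _≤_; _<_)
open import Data.Nat.Primality using (Prime)
open import Data.Integer using (+_; -_)
open import Data.Integer.Divisibility using () renaming (_∣_ to _∣ℤ_)

theorem3p4 : (p : ℕ) → Prime p → 5 ≤ p → LegendreIsMinusOne (- + 3) p →
    (α n i : ℕ) → 1 ≤ i → i < p →
    + 3 ∣ℤ S9bar (6 * p ^ (2 * α + 2) * n + (6 * i + p) * p ^ (2 * α + 1))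
theorem3p4 p isPrime 5≤p inert α n i 1≤i i<p =
  ≡.subst (λ N → + 3 ∣ℤ S9bar N) (≡.sym (index α n i))
    (ℤ∣.∣⇒∣ᵤ (Truncated.S9bar-vanishes _ (proj₁ ≡1-mod-3) (proj₂ ≡1-mod-3)
      (pent-unrepresented α _ (p∤6i+p+ n i 1≤i i<p))))
  where
  open Inert isPrime 5≤p inert
  ≡1-mod-3 : OneMod3 (p ^ suc (2 * α) * (6 * p * n + (6 * i + p)))
  ≡1-mod-3 = index-OneMod3 α n i
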